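{- Let $\pi \in \mathcal{S}_n(3\overline{1}52\overline{4})$. The dual permutation according to $f_{\mathsf{PS}}$ is given by $\pi^{*} =(\complement(\mathrm{rev}(\pi)))^{ -1}$.
   Context: $\pi$ avoids the barred pattern $3\overline{1}52\overline{4}$ if every occurrence of 231 plays the role of 352 in an occurrence of 31524. $\mathrm{rev}(\pi)=(\pi_n,\ldots,\pi_1)$, $\complement(\pi)=(n+1-\pi_1,\ldots,n+1-\pi_n)$. Ascent sequences: $a_1=0$, $a_i\le\mathsf{asc}(a_1,\ldots,a_{i-1})+1$. $\mathsf{RAsc}_n$: those with $a_k\in[0,a_{k-1}]\cup\{1+\mathsf{asc}(a_1,\ldots,a_{k-1})\}$ for $k>1$. $f_{\mathsf{AS}}$: start with $1$; a site between positions $i,i+1$ of $\pi$ is active if $\pi_i=1$ or $\pi_i-1$ lies left of $\pi_i$, plus both end sites; label active sites $0,1,\ldots$ from left to right; insert $k$ at active site $a_k$ for $k=2,\ldots,n$. $f_{\mathsf{AP}}$ maps ascent sequences to (2+2)-free posets: with strict downsets $\emptyset=D_0\subsetneq\cdots\subsetneq D_{\ell(P)}$, level $L_i$ = elements with strict downset $D_i$, $\ell^\star(P)$ = minimum level containing a maximal element; start from one element; if $a_{k+1}\le\ell^\star$ add a new maximal element covering the same elements as the elements of $L_{a_{k+1}}$; if $a_{k+1}=1+\ell$ add a new element covering all maximal elements; if $\ell^\star<a_{k+1}\le\ell$ add a new element covering what $L_{a_{k+1}}$ covers and add $x\prec y$ for maximal $x$ at level $<a_{k+1}$ and old $y$ at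 level $\ge a_{k+1}$. $f_{\mathsf{PA}}=f_{\mathsf{AP}}^{ -1}$ and $f_{\mathsf{PS}}=f_{\mathsf{AS}}\circ f_{\mathsf{PA}}$; it maps (2+2)-free posets having a chain with $\ell(P)+1$ elements bijectively onto $\mathcal{S}_n(3\overline{1}52\overline{4})$ (the image of $\mathsf{RAsc}_n$). The dual of $\pi=f_{\mathsf{PS}}(P)$ is $\pi^*=f_{\mathsf{PS}}(P^*)$, $P^*$ the order-reversed poset. -}

module Defs where

open import Data.Nat using (ℕ; zero; suc; _+_; _∸_; _≤_; _<_; _⊓_; _≡ᵇ_; _<ᵇ_; _≤ᵇ_)
open import Data.Bool using (Bool; true; false; _∧_; _∨_; not; if_then_else_)
open import Data.List using (List; []; _∷_; length; map; upTo; reverse; take; drop; _++_; filterᵇ; foldr)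
open import Data.Bool.ListAction using (any; all)
open import Data.List.Relation.Binary.Permutation.Propositional using (_↭_)
open import Data.Fin using (Fin; toℕ)
open import Data.Product using (Σ; _×_; ∃)
open import Function.Bundles using (_↔_; Inverse)
open import Relation.Binary.PropositionalEquality using (_≡_)

at : List ℕ → ℕ → ℕ
at []       _       = 0
at (x ∷ xs) zero    = x
at (x ∷ xs) (suc i) = at xs i

count : (ℕ → Bool) → ℕ → ℕ
count p m = length (filterᵇ p (upTo m))

IsPerm : ℕ → List ℕ → Set
IsPerm n π = π ↭ map suc (upTo n)

rev : List ℕ → List ℕ
rev = reverse

compl : ℕ → List ℕ → List ℕ
compl n π = map (λ x → suc n ∸ x) π

-- 1-based position of value v in π (0 if absent)
posOf : ℕ → List ℕ → ℕ
posOf v π = go 1 π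
  where
  go : ℕ → List ℕ → ℕ
  go i []       = 0
  go i (x ∷ xs) = if x ≡ᵇ v then i else go (suc i) xs

inv : List ℕ → List ℕ
inv π = map (λ v → posOf (suc v) π) (upTo (length π))

-- Avoidance of the barred pattern 3 1̄ 5 2 4̄ (positions 0-indexed):
-- every occurrence π_i π_j π_k (i<j<k) of 231 (π_k < π_i < π_j) plays the
-- role of 352 in an occurrence π_i π_p π_j π_k π_q of 31524, i.e. there
-- are p, q with i < p < j, π_p < π_k, k < q < length π, π_i < π_q < π_j.

Avoids31̄524̄ : List ℕ → Set
Avoids31̄524̄ π =
  ∀ i j k → i < j → j < k → k < length π →
  at π k < at π i → at π i < at π j →
  (∃ λ p → i < p × p < j × at π p < at π k) ×
  (∃ λ q → k < q × q < length π × at π i < at π q × at π q < at π j)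

asc : List ℕ → ℕ
asc []           = 0
asc (x ∷ [])     = 0
asc (x ∷ y ∷ xs) = (if x <ᵇ y then 1 else 0) + asc (y ∷ xs)

IsAscent : List ℕ → Set
IsAscent a = (1 ≤ length a) × (at a 0 ≡ 0) ×
  (∀ i → 1 ≤ i → i < length a → at a i ≤ suc (asc (take i a)))

-- site j (0 ≤ j ≤ length π) lies between π_j and π_{j+1} (1-based entries)
activeSite : List ℕ → ℕ → Bool
activeSite π zero    = true
activeSite π (suc j) =
  (suc j ≡ᵇ length π) ∨
  ((at π j ≡ᵇ 1) ∨ any (λ x → suc x ≡ᵇ at π j) (take j π))

activeSites : List ℕ → List ℕ
activeSites π = filterᵇ (activeSite π) (upTo (suc (length π)))

insertAt : ℕ → ℕ → List ℕ → List ℕ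
insertAt s k π = take s π ++ (k ∷ drop s π)

-- insert k at the active site labelled a (default: right end)
stepAS : ℕ → ℕ → List ℕ → List ℕ
stepAS k a π = insertAt (atD (activeSites π) a) k π
  where
  atD : List ℕ → ℕ → ℕ
  atD []       _       = length π
  atD (x ∷ xs) zero    = x
  atD (x ∷ xs) (suc i) = atD xs i

fAS : List ℕ → List ℕ
fAS []       = []
fAS (_ ∷ as) = go 2 as (1 ∷ [])
  where
  go : ℕ → List ℕ → List ℕ → List ℕ
  go k []       π = π
  go k (a ∷ as) π = go (suc k) as (stepAS k a π)

-- Finite posets on {0,…,size-1}, given by a strict order relation

record FPoset : Set where
  constructor mkP
  field
    size : ℕ
    rel  : ℕ → ℕ → Bool     -- rel x y = true  iff  x ≺ y

open FPoset public

anyB : ℕ → (ℕ → Bool) → Bool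
anyB m p = any p (upTo m)

allB : ℕ → (ℕ → Bool) → Bool
allB m p = all p (upTo m)

dsub : FPoset → ℕ → ℕ → Bool
dsub P x y = allB (size P) (λ z → not (rel P z x) ∨ rel P z y)

dsEq : FPoset → ℕ → ℕ → Bool
dsEq P x y = dsub P x y ∧ dsub P y x

dsStrict : FPoset → ℕ → ℕ → Bool
dsStrict P x y = dsub P x y ∧ not (dsub P y x)

isRep : FPoset → ℕ → Bool
isRep P y = not (anyB y (λ z → dsEq P z y))

-- level of x: the index i with D(x) = D_i, i.e. the number of distinct
-- strict downsets strictly contained in D(x) (downsets form a chain)
level : FPoset → ℕ → ℕ
level P x = count (λ y → isRep P y ∧ dsStrict P y x) (size P)

ell : FPoset → ℕ
ell P = count (isRep P) (size P) ∸ 1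

isMax : FPoset → ℕ → Bool
isMax P x = not (anyB (size P) (λ y → rel P x y))

ellStar : FPoset → ℕ
ellStar P = foldr (λ x r → level P x ⊓ r) (size P)
              (filterᵇ (isMax P) (upTo (size P)))

inD : FPoset → ℕ → ℕ → Bool
inD P i z = anyB (size P) (λ w → (level P w ≡ᵇ i) ∧ rel P z w)

stepAP : ℕ → FPoset → FPoset
stepAP a P = mkP (suc m) r
  where
  m = size P
  case1 = a ≤ᵇ ellStar P
  case3 = not case1 ∧ (a ≤ᵇ ell P)
  newBelow : ℕ → Bool
  newBelow z = if case1 ∨ case3 then inD P a z else true
  r : ℕ → ℕ → Bool
  r x y = if y ≡ᵇ m then ((x <ᵇ m) ∧ newBelow x)
          else if x ≡ᵇ m then false
          else (rel P x y ∨
                 (case3 ∧ isMax P x ∧ (level P x <ᵇ a) ∧ (a ≤ᵇ level P y)))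

fAP : List ℕ → FPoset
fAP []       = mkP 0 (λ _ _ → false)
fAP (_ ∷ as) = go as (mkP 1 (λ _ _ → false))
  where
  go : List ℕ → FPoset → FPoset
  go []       P = P
  go (a ∷ as) P = go as (stepAP a P)

dual : FPoset → FPoset
dual P = mkP (size P) (λ x y → rel P y x)

_≅P_ : FPoset → FPoset → Set
P ≅P Q = Σ (Fin (size P) ↔ Fin (size Q)) λ f →
  ∀ x y → rel P (toℕ x) (toℕ y) ≡ rel Q (toℕ (Inverse.to f x)) (toℕ (Inverse.to f y))

{-# OPTIONS --safe #-}

-- Represent f_AP of an ascent sequence minimally by intervals: x ≺ y iff
-- hi x < lo y, with lo and hi onto {0,…,ℓ}; then lo is the level.  Labelling
-- elements in order of insertion, f_AS of the same sequence lists the labels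
-- by increasing level and decreasing label.  A step with ℓ* < a ≤ ℓ leaves
-- both a 231 that breaks the barred pattern and a point interval [d,d] missing
-- forever.  So the pattern excludes such steps for a, and for b they are
-- excluded because duality preserves the set of point intervals up to reversal.
-- Without such steps the labels increase with hi, and decrease weakly with lo
-- where hi is constant.  Duality (lo , hi) ↦ (ℓ ∸ hi , ℓ ∸ lo) therefore
-- exchanges the label order and the position order and reverses both, which
-- is π ↦ (compl (rev π))⁻¹.
module Submission where

open import Defs
open import Data.Bool using (Bool; true; false; T; not; _∧_; _∨_; if_then_else_)
open import Data.Bool.ListAction using (any; all)
open import Data.Bool.Properties using (T?; ∨-identityʳ)
open import Data.Empty using (⊥-elim)
open import Data.Fin using (Fin; toℕ; fromℕ<)
open import Data.Fin.Permutation using (↔⇒≡)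
open import Data.Fin.Properties using (toℕ<n; toℕ-fromℕ<; toℕ-injective)
open import Data.List using (List; []; _∷_; _++_; [_]; length; map; upTo; applyUpTo; reverse; take; drop; filterᵇ; foldr; allFin)
open import Data.List.Membership.Propositional using (_∈_)
open import Data.List.Membership.Propositional.Properties using (∈-upTo⁺; ∈-upTo⁻; ∈-map⁺; ∈-map⁻; ∈-filter⁺; ∈-filter⁻; ∈-allFin)
open import Data.List.Membership.Propositional.Properties.WithK using (unique∧set⇒bag)
open import Data.List.Properties using (upTo-∷ʳ; filter-++; length-++; length-map; length-upTo; length-filter; length-reverse; unfold-reverse; map-upTo; map-∘; map-cong; map-cong-local; map-++; take++drop≡id; ∷-injectiveˡ; ∷-injectiveʳ)
open import Data.List.Relation.Binary.BagAndSetEquality using (∼bag⇒↭)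
open import Data.List.Relation.Binary.Permutation.Propositional using (_↭_; ↭-sym; ↭-trans; ↭-refl; prep; module PermutationReasoning)
open import Data.List.Relation.Binary.Permutation.Propositional.Properties using (↭-length; ∈-resp-↭; drop-∷; All-resp-↭; ↭-reverse; shift; ∷↭∷ʳ)
import Data.List.Relation.Binary.Permutation.Propositional.Properties as ↭
open import Data.List.Relation.Unary.All as All using (All; []; _∷_)
import Data.List.Relation.Unary.All.Properties as All
open import Data.List.Relation.Unary.AllPairs as AllPairs using (AllPairs; []; _∷_)
import Data.List.Relation.Unary.AllPairs.Properties as AllPairs
open import Data.List.Relation.Unary.Any using (here; there)
open import Data.List.Relation.Unary.Unique.Propositional using (Unique)
import Data.List.Relation.Unary.Unique.Propositional.Properties as Unique
open import Data.Nat
open import Data.Nat.Properties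
open import Data.Product using (∃; _×_; _,_; proj₁; proj₂)
open import Data.Sum using (_⊎_; inj₁; inj₂)
open import Function using (_∘_; id; flip)
open import Function.Bundles using (_↔_; Inverse; module Injection; mk⇔)
open import Function.Construct.Identity using (↔-id)
open import Function.Properties.Inverse using (↔⇒↣)
open import Relation.Binary.Definitions using (tri<; tri≈; tri>)
open import Relation.Binary.PropositionalEquality hiding ([_])
open import Relation.Nullary using (¬_; Dec; yes; no)
open import Relation.Nullary.Reflects using (Reflects; ofʸ; ofⁿ; _×-reflects_; _⊎-reflects_; ¬-reflects; fromEquivalence)

-- The isomorphism between the poset of `b` and the dual of that of `a` is arbitrary, and elements
-- with equal intervals can be exchanged, so it says nothing direct about labels. What it preserves
-- are the endpoints, hence the multiset of pairs (lo , hi). The comparison therefore runs through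
-- lists of such pairs: without splitting steps the label order sorts these pairs, and sorted lists
-- with the same contents coincide. The permutation is then recovered from lo alone. Two witnesses
-- against splitting steps are carried along because they serve different sides. The 231 is a
-- statement about labels, visible in π, where avoidance is assumed. Nothing is assumed about the
-- permutation of `b`, so there the witness has to be a property of intervals that isomorphism and
-- reversal respect. Point intervals provide it: a run without splitting steps has [d , d] at every
-- level d, since it opens each level with such an interval.

-- Booleans that reflect propositions

reflects-map : {A B : Set} {b : Bool} → (A → B) → (B → A) → Reflects A b → Reflects B b
reflects-map f g (ofʸ a)  = ofʸ (f a)
reflects-map f g (ofⁿ ¬a) = ofⁿ (¬a ∘ g)

reflects-true : {A : Set} {b : Bool} → Reflects A b → A → b ≡ true
reflects-true (ofʸ _)  _ = refl
reflects-true (ofⁿ ¬a) a = ⊥-elim (¬a a)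

reflects-false : {A : Set} {b : Bool} → Reflects A b → ¬ A → b ≡ false
reflects-false (ofʸ a) ¬a = ⊥-elim (¬a a)
reflects-false (ofⁿ _) _  = refl

reflects-T⁻ : {A : Set} {b : Bool} → Reflects A b → T b → A
reflects-T⁻ (ofʸ a) _ = a

reflects-T⁺ : {A : Set} {b : Bool} → Reflects A b → A → T b
reflects-T⁺ (ofʸ _)  _ = _
reflects-T⁺ (ofⁿ ¬a) a = ⊥-elim (¬a a)

≡ᵇ-reflects-≡ : ∀ m n → Reflects (m ≡ n) (m ≡ᵇ n)
≡ᵇ-reflects-≡ m n = fromEquivalence (≡ᵇ⇒≡ m n) (≡⇒≡ᵇ m n)

any-reflects : ∀ {Q : ℕ → Set} {p} xs → (∀ {x} → x ∈ xs → Reflects (Q x) (p x)) →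
  Reflects (∃ λ x → x ∈ xs × Q x) (any p xs)
any-reflects [] r = ofⁿ λ ()
any-reflects (x ∷ xs) r = reflects-map
  (λ { (inj₁ q) → x , here refl , q ; (inj₂ (y , y∈ , q)) → y , there y∈ , q })
  (λ { (_ , here refl , q) → inj₁ q ; (y , there y∈ , q) → inj₂ (y , y∈ , q) })
  (r (here refl) ⊎-reflects any-reflects xs (r ∘ there))

all-reflects : ∀ {Q : ℕ → Set} {p} xs → (∀ {x} → x ∈ xs → Reflects (Q x) (p x)) →
  Reflects (All Q xs) (all p xs)
all-reflects [] r = ofʸ []
all-reflects (x ∷ xs) r = reflects-map (λ { (q , qs) → q ∷ qs }) (λ { (q ∷ qs) → q , qs })
  (r (here refl) ×-reflects all-reflects xs (r ∘ there))

anyB-reflects : ∀ {Q : ℕ → Set} {p} n → (∀ {x} → x < n → Reflects (Q x) (p x)) →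
  Reflects (∃ λ x → x < n × Q x) (anyB n p)
anyB-reflects n r = reflects-map
  (λ { (x , x∈ , q) → x , ∈-upTo⁻ x∈ , q })
  (λ { (x , x< , q) → x , ∈-upTo⁺ x< , q })
  (any-reflects (upTo n) (r ∘ ∈-upTo⁻))

allB-reflects : ∀ {Q : ℕ → Set} {p} n → (∀ {x} → x < n → Reflects (Q x) (p x)) →
  Reflects (∀ {x} → x < n → Q x) (allB n p)
allB-reflects n r = reflects-map (λ q {x} x< → All.lookup q (∈-upTo⁺ x<))
  (λ q → All.tabulate λ x∈ → q (∈-upTo⁻ x∈))
  (all-reflects (upTo n) (r ∘ ∈-upTo⁻))

-- Permutations and sorted lists

unique-↭ : {A : Set} {xs ys : List A} → Unique xs → Unique ys →
  (∀ {x} → x ∈ xs → x ∈ ys) → (∀ {x} → x ∈ ys → x ∈ xs) → xs ↭ ys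
unique-↭ ux uy f g = ∼bag⇒↭ (unique∧set⇒bag ux uy (mk⇔ f g))

-- If each head occurs in the tail of the other list, `R` holds both ways between the heads and
-- antisymmetry identifies them. Repeated entries are allowed, which matters for lists of endpoint
-- pairs.
AllPairs-↭⇒≡ : {A : Set} {R : A → A → Set} → (∀ {x y} → R x y → R y x → x ≡ y) →
  ∀ {xs ys} → AllPairs R xs → AllPairs R ys → xs ↭ ys → xs ≡ ys
AllPairs-↭⇒≡ anti {[]} {[]} _ _ _ = refl
AllPairs-↭⇒≡ anti {[]} {_ ∷ _} _ _ p with () ← ↭-length p
AllPairs-↭⇒≡ anti {_ ∷ _} {[]} _ _ p with () ← ↭-length p
AllPairs-↭⇒≡ {A} {R} anti {x ∷ xs} {y ∷ ys} (rx ∷ rxs) (ry ∷ rys) p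
  = tails (heads (∈-resp-↭ p (here refl)) (∈-resp-↭ (↭-sym p) (here refl))) p
  where
  tails : x ≡ y → x ∷ xs ↭ y ∷ ys → x ∷ xs ≡ y ∷ ys
  tails refl p = cong (x ∷_) (AllPairs-↭⇒≡ anti rxs rys (drop-∷ p))

  heads : x ∈ y ∷ ys → y ∈ x ∷ xs → x ≡ y
  heads (here x≡y) _ = x≡y
  heads (there _) (here y≡x) = sym y≡x
  heads (there x∈) (there y∈) = anti (All.lookup rx y∈) (All.lookup ry x∈)

AllPairs-reverse : {A : Set} {R : A → A → Set} → ∀ {xs} →
  AllPairs R xs → AllPairs (flip R) (reverse xs)
AllPairs-reverse {xs = []} [] = []
AllPairs-reverse {xs = x ∷ xs} (rx ∷ rxs) rewrite unfold-reverse x xs =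
  AllPairs.++⁺ (AllPairs-reverse rxs) ([] ∷ [])
    (All.map (λ r → r ∷ []) (All-resp-↭ (↭-sym (↭-reverse xs)) rx))

AllPairs-restrict : {A : Set} {P : A → Set} {R : A → A → Set} → ∀ {xs} →
  AllPairs (λ x y → P y → R x y) xs → All P xs → AllPairs R xs
AllPairs-restrict [] [] = []
AllPairs-restrict (r ∷ rs) (_ ∷ ps) =
  All.zipWith (λ { (f , p) → f p }) (r , ps) ∷ AllPairs-restrict rs ps

-- Positions in lists

at-∈ : ∀ {xs i} → i < length xs → at xs i ∈ xs
at-∈ {_ ∷ _} {zero}  _         = here refl
at-∈ {_ ∷ _} {suc i} (s≤s i<) = there (at-∈ i<)

∈-at : ∀ {xs x} → x ∈ xs → ∃ λ i → i < length xs × at xs i ≡ x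
∈-at (here refl) = 0 , z<s , refl
∈-at (there x∈) with i , i< , e ← ∈-at x∈ = suc i , s≤s i< , e

AllPairs-at : ∀ {R : ℕ → ℕ → Set} {xs i j} → AllPairs R xs → i < j → j < length xs →
  R (at xs i) (at xs j)
AllPairs-at {i = zero}  {suc j} (r ∷ _)  _         (s≤s j<) = All.lookup r (at-∈ j<)
AllPairs-at {i = suc i} {suc j} (_ ∷ rs) (s≤s i<j) (s≤s j<) = AllPairs-at rs i<j j<

∈-take⇒at : ∀ {xs j x} → x ∈ take j xs → ∃ λ i → i < j × i < length xs × at xs i ≡ x
∈-take⇒at {_ ∷ _} {suc j} (here refl) = 0 , z<s , z<s , refl
∈-take⇒at {_ ∷ _} {suc j} (there x∈) with i , i<j , i< , e ← ∈-take⇒at x∈ =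
  suc i , s≤s i<j , s≤s i< , e

at∈take : ∀ {xs i j} → i < j → i < length xs → at xs i ∈ take j xs
at∈take {_ ∷ _} {zero}  {suc j} _         _        = here refl
at∈take {_ ∷ _} {suc i} {suc j} (s≤s i<j) (s≤s i<) = there (at∈take i<j i<)

map-≡-applyUpTo : {A : Set} {h : ℕ → A} {k : ℕ → A} → ∀ xs n → map h xs ≡ applyUpTo k n →
  ∀ {i} → i < length xs → h (at xs i) ≡ k i
map-≡-applyUpTo (x ∷ xs) (suc n) e {zero} _ = ∷-injectiveˡ e
map-≡-applyUpTo (x ∷ xs) (suc n) e {suc i} (s≤s i<) =
  map-≡-applyUpTo xs n (∷-injectiveʳ e) i<

-- Counting values by their first occurrences

least : ∀ (f : ℕ → ℕ) v n →
  (∃ λ y → y < n × f y ≡ v × (∀ {z} → z < y → f z ≢ v)) ⊎ (∀ {z} → z < n → f z ≢ v)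
least f v zero = inj₂ λ ()
least f v (suc n) with least f v n
... | inj₁ (y , y< , e , m) = inj₁ (y , m<n⇒m<1+n y< , e , m)
... | inj₂ none with f n ≟ v
...   | yes e = inj₁ (n , n<1+n n , e , none)
...   | no ¬e = inj₂ none′
  where
  none′ : ∀ {z} → z < suc n → f z ≢ v
  none′ (s≤s z≤) with m≤n⇒m<n∨m≡n z≤
  ... | inj₁ z<n  = none z<n
  ... | inj₂ refl = ¬e

-- `f` maps the first occurrences of values below `v` bijectively onto {0,...,v-1}. With `f` the
-- lower endpoint this evaluates both `level` and `ell`, which count one representative per downset.
count-first : ∀ (f : ℕ → ℕ) {p : ℕ → Bool} n v →
  (∀ {y} → y < n → Reflects ((∀ z → z < y → f z ≢ f y) × f y < v) (p y)) →
  (∀ {i} → i < v → ∃ λ y → y < n × f y ≡ i) →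
  count p n ≡ v
count-first f {p} n v r sur = begin
  length firsts           ≡⟨ length-map f firsts ⟨
  length (map f firsts)   ≡⟨ ↭-length (unique-↭ unique (Unique.upTo⁺ v) sound complete) ⟩
  length (upTo v)         ≡⟨ length-upTo v ⟩
  v                       ∎
  where
  open ≡-Reasoning
  firsts = filterᵇ p (upTo n)

  P : ℕ → Set
  P y = y < n × T (p y)

  p? : ∀ y → Dec (T (p y))
  p? y = T? (p y)

  first⇒P : ∀ {y} → y ∈ firsts → P y
  first⇒P y∈ with y∈′ , py ← ∈-filter⁻ p? {xs = upTo n} y∈ = ∈-upTo⁻ y∈′ , py

  unique : Unique (map f firsts)
  unique = AllPairs.map⁺ (AllPairs-restrict
    (AllPairs.filter⁺ p? (AllPairs.applyUpTo⁺₁ id n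
      λ i<j _ (j<n , pj) → proj₁ (reflects-T⁻ (r j<n) pj) _ i<j))
    (All.tabulate first⇒P))

  sound : ∀ {i} → i ∈ map f firsts → i ∈ upTo v
  sound i∈ with y , y∈ , refl ← ∈-map⁻ f i∈
    with y<n , py ← first⇒P y∈ =
    ∈-upTo⁺ (proj₂ (reflects-T⁻ (r y<n) py))

  complete : ∀ {i} → i ∈ upTo v → i ∈ map f firsts
  complete {i} i∈ with least f i n
  ... | inj₁ (y , y<n , refl , m) =
    ∈-map⁺ f (∈-filter⁺ p? (∈-upTo⁺ y<n) (reflects-T⁺ (r y<n) ((λ _ → m) , ∈-upTo⁻ i∈)))
  ... | inj₂ none with y , y<n , e ← sur (∈-upTo⁻ i∈) = ⊥-elim (none y<n e)

count-suc : ∀ p n → count p (suc n) ≡ count p n + (if p n then 1 else 0)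
count-suc p n = begin
  length (filterᵇ p (upTo (suc n)))                       ≡⟨ cong (length ∘ filterᵇ p) (upTo-∷ʳ n) ⟨
  length (filterᵇ p (upTo n ++ [ n ]))                    ≡⟨ cong length (filter-++ p? (upTo n) [ n ]) ⟩
  length (filterᵇ p (upTo n) ++ filterᵇ p [ n ])          ≡⟨ length-++ (filterᵇ p (upTo n)) ⟩
  count p n + length (filterᵇ p [ n ])                    ≡⟨ cong (count p n +_) single ⟩
  count p n + (if p n then 1 else 0)                      ∎
  where
  open ≡-Reasoning
  p? : ∀ y → Dec (T (p y))
  p? y = T? (p y)
  single : length (filterᵇ p [ n ]) ≡ (if p n then 1 else 0)
  single with p n
  ... | true  = refl
  ... | false = refl

-- Indices in filtered lists and positions of values

nth : ℕ → List ℕ → ℕ → ℕ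
nth d []       _       = d
nth d (x ∷ xs) zero    = x
nth d (x ∷ xs) (suc i) = nth d xs i

-- The index of a selected element is the number of selected ones before it; the label of an active
-- site is such an index.
nth-filterᵇ : ∀ d p f {s N} → s < N → p (f s) ≡ true →
  nth d (filterᵇ p (applyUpTo f N)) (length (filterᵇ p (applyUpTo f s))) ≡ f s
nth-filterᵇ d p f {zero} {suc N} _ e with p (f 0) | e
... | true | refl = refl
nth-filterᵇ d p f {suc s} {suc N} (s≤s s<N) e with p (f 0)
... | true  = nth-filterᵇ d p (f ∘ suc) s<N e
... | false = nth-filterᵇ d p (f ∘ suc) s<N e

index : ℕ → List ℕ → ℕ → ℕ
index v []       i = 0
index v (x ∷ xs) i = if x ≡ᵇ v then i else index v xs (suc i)

-- The local functions of Defs have no name outside it.  Here and below such a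
-- function is captured as the solution of a metavariable; abstracting its
-- arguments in the unfolding lemma turns them into distinct variables, which
-- makes the solution unique.
mutual
  posGo : ℕ → List ℕ → ℕ → List ℕ → ℕ
  posGo = _

  posOf-unfold : ∀ v x xs → posOf v (x ∷ xs) ≡ (if x ≡ᵇ v then 1 else posGo v (x ∷ xs) 2 xs)
  posOf-unfold v x xs with x ≡ᵇ v
  ... | true = refl
  ... | false with 2 | x ∷ xs
  ...   | k | ys = refl

posGo≡index : ∀ v ys i xs → posGo v ys i xs ≡ index v xs i
posGo≡index v ys i [] = refl
posGo≡index v ys i (x ∷ xs) with x ≡ᵇ v
... | true  = refl
... | false = posGo≡index v ys (suc i) xs

index-correct : ∀ {v} xs i → v ∈ xs → ∃ λ p → p < length xs × at xs p ≡ v × index v xs i ≡ i + p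
index-correct {v} (x ∷ xs) i v∈ with x ≡ᵇ v | ≡ᵇ-reflects-≡ x v
... | true  | ofʸ x≡v = 0 , z<s , x≡v , sym (+-identityʳ i)
... | false | ofⁿ x≢v with v∈
...   | here refl = ⊥-elim (x≢v refl)
...   | there v∈′ with p , p< , e , q ← index-correct xs (suc i) v∈′ =
  suc p , s≤s p< , e , trans q (sym (+-suc i p))

posOf≡index : ∀ v xs → posOf v xs ≡ index v xs 1
posOf≡index v [] = refl
posOf≡index v (x ∷ xs) rewrite posOf-unfold v x xs | posGo≡index v (x ∷ xs) 2 xs = refl

posOf-correct : ∀ {v} xs → v ∈ xs → ∃ λ p → p < length xs × at xs p ≡ v × posOf v xs ≡ suc p
posOf-correct {v} xs v∈ rewrite posOf≡index v xs = index-correct xs 1 v∈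

-- Interval orders

-- Element x of an interval order is the interval [lo x , hi x]; both
-- endpoint maps are onto {0,…,ℓ}, so the representation is the minimal one.
record Intervals (k ℓ : ℕ) (lo hi : ℕ → ℕ) : Set where
  field
    lo≤hi   : ∀ {x} → x < suc k → lo x ≤ hi x
    hi≤ℓ    : ∀ {x} → x < suc k → hi x ≤ ℓ
    lo-onto : ∀ {i} → i ≤ ℓ → ∃ λ x → x < suc k × lo x ≡ i
    hi-onto : ∀ {i} → i ≤ ℓ → ∃ λ x → x < suc k × hi x ≡ i

  lo≤ℓ : ∀ {x} → x < suc k → lo x ≤ ℓ
  lo≤ℓ x< = ≤-trans (lo≤hi x<) (hi≤ℓ x<)

IntervalOrder : ℕ → (ℕ → ℕ → Bool) → (ℕ → ℕ) → (ℕ → ℕ) → Set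
IntervalOrder k r lo hi = ∀ {x y} → x < suc k → y < suc k → Reflects (hi x < lo y) (r x y)

foldr-⊓≤ : ∀ (f : ℕ → ℕ) N {x xs} → x ∈ xs → foldr (λ y r → f y ⊓ r) N xs ≤ f x
foldr-⊓≤ f N (here refl) = m⊓n≤m _ _
foldr-⊓≤ f N (there x∈)  = ≤-trans (m⊓n≤n _ _) (foldr-⊓≤ f N x∈)

foldr-⊓≥ : ∀ (f : ℕ → ℕ) {N v} xs → v ≤ N → (∀ {x} → x ∈ xs → v ≤ f x) →
  v ≤ foldr (λ y r → f y ⊓ r) N xs
foldr-⊓≥ f []       v≤N h = v≤N
foldr-⊓≥ f (x ∷ xs) v≤N h = ⊓-glb (h (here refl)) (foldr-⊓≥ f xs v≤N (h ∘ there))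

module IntervalFacts {k ℓ lo hi r} (I : Intervals k ℓ lo hi) (rep : IntervalOrder k r lo hi) where
  open Intervals I

  P : FPoset
  P = mkP (suc k) r

  -- If lo y < lo x, an element z with hi z = lo y lies below x but not below y; it exists because
  -- `hi` is onto.
  dsub-reflects : ∀ {x y} → x < suc k → y < suc k → Reflects (lo x ≤ lo y) (dsub P x y)
  dsub-reflects {x} {y} x< y< = reflects-map to from
    (allB-reflects (suc k) λ z< → ¬-reflects (rep z< x<) ⊎-reflects rep z< y<)
    where
    to : (∀ {z} → z < suc k → ¬ (hi z < lo x) ⊎ hi z < lo y) → lo x ≤ lo y
    to h with lo x ≤? lo y
    ... | yes le = le
    ... | no ¬le with z , z< , e ← hi-onto (lo≤ℓ y<) with h z<
    ...   | inj₁ hz≮ = ⊥-elim (hz≮ (subst (_< lo x) (sym e) (≰⇒> ¬le)))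
    ...   | inj₂ hz< = ⊥-elim (<-irrefl e hz<)
    from : lo x ≤ lo y → ∀ {z} → z < suc k → ¬ (hi z < lo x) ⊎ hi z < lo y
    from le {z} _ with hi z <? lo x
    ... | yes lt = inj₂ (<-≤-trans lt le)
    ... | no ¬lt = inj₁ ¬lt

  dsEq-reflects : ∀ {x y} → x < suc k → y < suc k → Reflects (lo x ≡ lo y) (dsEq P x y)
  dsEq-reflects x< y< = reflects-map (λ (p , q) → ≤-antisym p q) (λ e → ≤-reflexive e , ≤-reflexive (sym e))
    (dsub-reflects x< y< ×-reflects dsub-reflects y< x<)

  dsStrict-reflects : ∀ {x y} → x < suc k → y < suc k → Reflects (lo x < lo y) (dsStrict P x y)
  dsStrict-reflects x< y< = reflects-map (λ (_ , ≱) → ≰⇒> ≱) (λ lt → <⇒≤ lt , <⇒≱ lt)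
    (dsub-reflects x< y< ×-reflects ¬-reflects (dsub-reflects y< x<))

  isRep-reflects : ∀ {y} → y < suc k → Reflects (∀ z → z < y → lo z ≢ lo y) (isRep P y)
  isRep-reflects {y} y< = reflects-map to from
    (¬-reflects (anyB-reflects y λ z<y → dsEq-reflects (<-trans z<y y<) y<))
    where
    to : ¬ (∃ λ z → z < y × lo z ≡ lo y) → ∀ z → z < y → lo z ≢ lo y
    to ¬∃ z z<y e = ¬∃ (z , z<y , e)
    from : (∀ z → z < y → lo z ≢ lo y) → ¬ (∃ λ z → z < y × lo z ≡ lo y)
    from h (z , z<y , e) = h z z<y e

  level≡lo : ∀ {x} → x < suc k → level P x ≡ lo x
  level≡lo {x} x< = count-first lo (suc k) (lo x)
    (λ y< → isRep-reflects y< ×-reflects dsStrict-reflects y< x<)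
    (λ i< → lo-onto (≤-trans (<⇒≤ i<) (lo≤ℓ x<)))

  levels≡ : count (isRep P) (suc k) ≡ suc ℓ
  levels≡ = count-first lo (suc k) (suc ℓ)
    (λ y< → reflects-map (λ f → f , s≤s (lo≤ℓ y<)) proj₁ (isRep-reflects y<))
    (λ i< → lo-onto (s≤s⁻¹ i<))

  ell≡ℓ : ell P ≡ ℓ
  ell≡ℓ = cong (_∸ 1) levels≡

  ℓ<suck : ℓ < suc k
  ℓ<suck = begin
    suc ℓ                   ≡⟨ levels≡ ⟨
    count (isRep P) (suc k) ≤⟨ length-filter (λ x → T? (isRep P x)) (upTo (suc k)) ⟩
    length (upTo (suc k))   ≡⟨ length-upTo (suc k) ⟩
    suc k                   ∎
    where open ≤-Reasoning

  isMax-reflects : ∀ {x} → x < suc k → Reflects (hi x ≡ ℓ) (isMax P x)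
  isMax-reflects {x} x< = reflects-map to from (¬-reflects (anyB-reflects (suc k) (rep x<)))
    where
    to : ¬ (∃ λ y → y < suc k × hi x < lo y) → hi x ≡ ℓ
    to ¬∃ with m≤n⇒m<n∨m≡n (hi≤ℓ x<)
    ... | inj₂ e = e
    ... | inj₁ lt with y , y< , e ← lo-onto ≤-refl = ⊥-elim (¬∃ (y , y< , subst (hi x <_) (sym e) lt))
    from : hi x ≡ ℓ → ¬ (∃ λ y → y < suc k × hi x < lo y)
    from e (y , y< , lt) = <⇒≱ lt (subst (lo y ≤_) (sym e) (lo≤ℓ y<))

  ellStar≡ : hi k ≡ ℓ → (∀ {x} → x < suc k → hi x ≡ ℓ → lo k ≤ lo x) → ellStar P ≡ lo k
  ellStar≡ top low = ≤-antisym
    (≤-trans (foldr-⊓≤ (level P) (suc k) {xs = maxs}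
               (∈-filter⁺ max? (∈-upTo⁺ (n<1+n k)) (reflects-T⁺ (isMax-reflects (n<1+n k)) top)))
             (≤-reflexive (level≡lo (n<1+n k))))
    -- The fold starts from `size P`, so this default must also be at least lo k; it is, since there
    -- are no more levels than elements.
    (foldr-⊓≥ (level P) maxs (≤-trans (lo≤ℓ (n<1+n k)) (<⇒≤ ℓ<suck)) below)
    where
    max? : ∀ x → Dec (T (isMax P x))
    max? x = T? (isMax P x)
    maxs = filterᵇ (isMax P) (upTo (suc k))
    below : ∀ {x} → x ∈ maxs → lo k ≤ level P x
    below {x} x∈ with x∈′ , mx ← ∈-filter⁻ max? {xs = upTo (suc k)} x∈ with x< ← ∈-upTo⁻ x∈′ =
      subst (lo k ≤_) (sym (level≡lo x<)) (low x< (reflects-T⁻ (isMax-reflects x<) mx))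

  -- All elements of level a have the downset {z : hi z < a}, and a ≤ ℓ provides such an element.
  inD-reflects : ∀ {a z} → a ≤ ℓ → z < suc k → Reflects (hi z < a) (inD P a z)
  inD-reflects {a} {z} a≤ℓ z< = reflects-map to from
    (anyB-reflects (suc k) λ {w} w< →
      reflects-map (trans (sym (level≡lo w<))) (trans (level≡lo w<)) (≡ᵇ-reflects-≡ (level P w) a)
        ×-reflects rep z< w<)
    where
    to : (∃ λ w → w < suc k × lo w ≡ a × hi z < lo w) → hi z < a
    to (w , _ , refl , lt) = lt
    from : hi z < a → ∃ λ w → w < suc k × lo w ≡ a × hi z < lo w
    from lt with w , w< , refl ← lo-onto a≤ℓ = w , w< , refl , lt

-- The order relation after one insertion

≡ᵇ-refl : ∀ n → (n ≡ᵇ n) ≡ true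
≡ᵇ-refl n = reflects-true (≡ᵇ-reflects-≡ n n) refl

<⇒≡ᵇ-false : ∀ {m n} → m < n → (m ≡ᵇ n) ≡ false
<⇒≡ᵇ-false {m} {n} m<n = reflects-false (≡ᵇ-reflects-≡ m n) (<⇒≢ m<n)

<⇒<ᵇ-true : ∀ {m n} → m < n → (m <ᵇ n) ≡ true
<⇒<ᵇ-true {m} {n} = reflects-true (<ᵇ-reflects-< m n)

splitting : ℕ → FPoset → Bool
splitting a P = not (a ≤ᵇ ellStar P) ∧ (a ≤ᵇ ell P)

stepAP-old : ∀ a P {x y} → x < size P → y < size P → rel (stepAP a P) x y ≡
  rel P x y ∨ (splitting a P ∧ isMax P x ∧ (level P x <ᵇ a) ∧ (a ≤ᵇ level P y))
stepAP-old a P x< y< rewrite <⇒≡ᵇ-false y< | <⇒≡ᵇ-false x< = refl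

stepAP-new : ∀ a P {x} → x < size P → rel (stepAP a P) x (size P) ≡
  (if (a ≤ᵇ ellStar P) ∨ splitting a P then inD P a x else true)
stepAP-new a P x< rewrite ≡ᵇ-refl (size P) | <⇒<ᵇ-true x< = refl

stepAP-top : ∀ a P {y} → y < suc (size P) → rel (stepAP a P) (size P) y ≡ false
stepAP-top a P {y} y< with m<1+n⇒m<n∨m≡n y<
... | inj₁ y<m rewrite <⇒≡ᵇ-false y<m | ≡ᵇ-refl (size P) = refl
... | inj₂ refl rewrite ≡ᵇ-refl (size P) | reflects-false (<ᵇ-reflects-< (size P) (size P)) (<-irrefl refl) = refl

extend : ℕ → (ℕ → ℕ) → ℕ → ℕ → ℕ
extend n f v x = if x <ᵇ n then f x else v

extend-old : ∀ {n f v x} → x < n → extend n f v x ≡ f x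
extend-old x< rewrite <⇒<ᵇ-true x< = refl

extend-new : ∀ {n f v} → extend n f v n ≡ v
extend-new {n} rewrite reflects-false (<ᵇ-reflects-< n n) (<-irrefl refl) = refl

-- Renumbering levels around a new one

-- The increasing enumeration of the natural numbers other than `a`.
lift : ℕ → ℕ → ℕ
lift a v = if a ≤ᵇ v then suc v else v

lift-≥ : ∀ {a v} → a ≤ v → lift a v ≡ suc v
lift-≥ {a} {v} a≤v rewrite reflects-true (≤ᵇ-reflects-≤ a v) a≤v = refl

lift-< : ∀ {a v} → v < a → lift a v ≡ v
lift-< {a} {v} v<a rewrite reflects-false (≤ᵇ-reflects-≤ a v) (<⇒≱ v<a) = refl

lift-mono-< : ∀ a {u v} → u < v → lift a u < lift a v
lift-mono-< a {u} {v} u<v with a ≤? u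
... | yes a≤u rewrite lift-≥ a≤u | lift-≥ (≤-trans a≤u (<⇒≤ u<v)) = s≤s u<v
... | no a≰u rewrite lift-< (≰⇒> a≰u) with a ≤? v
...   | yes a≤v rewrite lift-≥ a≤v = m<n⇒m<1+n u<v
...   | no a≰v rewrite lift-< (≰⇒> a≰v) = u<v

lift-mono-≤ : ∀ a {u v} → u ≤ v → lift a u ≤ lift a v
lift-mono-≤ a u≤v with m≤n⇒m<n∨m≡n u≤v
... | inj₁ u<v  = <⇒≤ (lift-mono-< a u<v)
... | inj₂ refl = ≤-refl

lift-cancel-≤ : ∀ a {u v} → lift a u ≤ lift a v → u ≤ v
lift-cancel-≤ a le = ≮⇒≥ λ v<u → <⇒≱ (lift-mono-< a v<u) le

lift-cancel-< : ∀ a {u v} → lift a u < lift a v → u < v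
lift-cancel-< a lt = ≰⇒> λ v≤u → <⇒≱ lt (lift-mono-≤ a v≤u)

lift-injective : ∀ a {u v} → lift a u ≡ lift a v → u ≡ v
lift-injective a e = ≤-antisym (lift-cancel-≤ a (≤-reflexive e)) (lift-cancel-≤ a (≤-reflexive (sym e)))

lift≢ : ∀ a v → lift a v ≢ a
lift≢ a v e with a ≤? v
... | yes a≤v = <⇒≢ (s≤s a≤v) (sym (trans (sym (lift-≥ a≤v)) e))
... | no a≰v = <⇒≢ (≰⇒> a≰v) (trans (sym (lift-< (≰⇒> a≰v))) e)

lift-bound : ∀ a v → lift a v ≤ suc v
lift-bound a v with a ≤? v
... | yes a≤v = ≤-reflexive (lift-≥ a≤v)
... | no a≰v = ≤-trans (≤-reflexive (lift-< (≰⇒> a≰v))) (n≤1+n v)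

lift-inflate : ∀ a v → v ≤ lift a v
lift-inflate a v with a ≤? v
... | yes a≤v = ≤-trans (n≤1+n v) (≤-reflexive (sym (lift-≥ a≤v)))
... | no a≰v = ≤-reflexive (sym (lift-< (≰⇒> a≰v)))

-- The three kinds of insertion step

record Extends (k : ℕ) (f : ℕ → ℕ) (v : ℕ) (f′ : ℕ → ℕ) : Set where
  field
    old : ∀ {x} → x < suc k → f′ x ≡ f x
    new : f′ (suc k) ≡ v

extend-extends : ∀ k f v → Extends k f v (extend (suc k) f v)
extend-extends k f v = record { old = extend-old {f = f} ; new = extend-new {suc k} {f} }

-- The site to the right of the label of suc x is active iff the label of x
-- occurs earlier, i.e. iff lo x < lo (suc x).  This being equivalent to suc x
-- being minimal in its level, the active sites are the level boundaries.
record LevelMinima (k : ℕ) (lo : ℕ → ℕ) : Set where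
  field
    ascent⇒min  : ∀ {x} → suc x < suc k → lo x < lo (suc x) →
      ∀ {y} → y < suc k → lo y ≡ lo (suc x) → suc x ≤ y
    min⇒ascent : ∀ {x} → suc x < suc k → lo (suc x) ≤ lo x →
      ∃ λ y → y < suc x × lo y ≡ lo (suc x)

-- By `last-hi` and `last-low` the newest element attains ℓ*, so ℓ* is lo k, the last entry of the
-- sequence. The test made by `stepAP` is thus the test for an ascent, and ℓ counts the ascents.
record State (k ℓ : ℕ) (lo hi : ℕ → ℕ) : Set where
  field
    intervals : Intervals k ℓ lo hi
    minima    : LevelMinima k lo
    last-hi   : hi k ≡ ℓ
    last-low  : ∀ {x} → x < suc k → hi x ≡ ℓ → lo k ≤ lo x
  open Intervals intervals public
  open LevelMinima minima public

Ordered : ℕ → (ℕ → ℕ) → (ℕ → ℕ) → Set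
Ordered k lo hi = ∀ {x y} → x < y → y < suc k → hi x < hi y ⊎ (hi x ≡ hi y × lo y ≤ lo x)

FullDiagonal : ℕ → ℕ → (ℕ → ℕ) → (ℕ → ℕ) → Set
FullDiagonal k ℓ lo hi = ∀ {d} → d ≤ ℓ → ∃ λ x → x < suc k × lo x ≡ d × hi x ≡ d

-- The labels x + 1, x + 2, y + 1 stand in this order in π and form a 231. Its first two values are
-- consecutive, so no value can play the barred 4.
Bad231 : ℕ → (ℕ → ℕ) → Set
Bad231 k lo = ∃ λ x → ∃ λ y → suc x < suc k × y < x × lo x < lo (suc x) × lo (suc x) < lo y

DiagonalGap : ℕ → ℕ → (ℕ → ℕ) → (ℕ → ℕ) → Set
DiagonalGap k ℓ lo hi = ∃ λ d → d ≤ ℓ × (∀ {x} → x < suc k → lo x ≡ d → hi x ≢ d)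

-- `ordered` is the label order used in the final comparison; `diagonal` is carried over to the
-- other poset, where it refutes a gap.
record Restricted (k ℓ : ℕ) (lo hi : ℕ → ℕ) : Set where
  field
    ordered  : Ordered k lo hi
    diagonal : FullDiagonal k ℓ lo hi

record Unrestricted (k ℓ : ℕ) (lo hi : ℕ → ℕ) : Set where
  field
    bad : Bad231 k lo
    gap : DiagonalGap k ℓ lo hi

Dichotomy : ℕ → ℕ → (ℕ → ℕ) → (ℕ → ℕ) → Set
Dichotomy k ℓ lo hi = Restricted k ℓ lo hi ⊎ Unrestricted k ℓ lo hi

-- The witness consists of old elements, and every step keeps strict inequalities between their
-- levels.
bad231-mono : ∀ {k lo lo′} → (∀ {x y} → x < suc k → y < suc k → lo x < lo y → lo′ x < lo′ y) →
  Bad231 k lo → Bad231 (suc k) lo′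
bad231-mono mono (x , y , x< , y<x , p , q) =
  x , y , m<n⇒m<1+n x< , y<x , mono (<⇒≤ x<) x< p , mono x< (<-trans y<x (<⇒≤ x<)) q

module LowStep {k ℓ lo hi} (S : State k ℓ lo hi) {a} (a≤ : a ≤ lo k)
  {lo′ hi′} (L : Extends k lo a lo′) (H : Extends k hi ℓ hi′) where
  open State S
  module L = Extends L
  module H = Extends H

  a≤ℓ : a ≤ ℓ
  a≤ℓ = ≤-trans a≤ (lo≤ℓ (n<1+n k))

  intervals′ : Intervals (suc k) ℓ lo′ hi′
  intervals′ = record { lo≤hi = lo≤hi′ ; hi≤ℓ = hi≤ℓ′ ; lo-onto = lo-onto′ ; hi-onto = hi-onto′ }
    where
    lo≤hi′ : ∀ {x} → x < suc (suc k) → lo′ x ≤ hi′ x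
    lo≤hi′ x< with m<1+n⇒m<n∨m≡n x<
    ... | inj₁ x<′ rewrite L.old x<′ | H.old x<′ = lo≤hi x<′
    ... | inj₂ refl rewrite L.new | H.new = a≤ℓ
    hi≤ℓ′ : ∀ {x} → x < suc (suc k) → hi′ x ≤ ℓ
    hi≤ℓ′ x< with m<1+n⇒m<n∨m≡n x<
    ... | inj₁ x<′ rewrite H.old x<′ = hi≤ℓ x<′
    ... | inj₂ refl rewrite H.new = ≤-refl
    lo-onto′ : ∀ {i} → i ≤ ℓ → ∃ λ x → x < suc (suc k) × lo′ x ≡ i
    lo-onto′ i≤ with x , x< , e ← lo-onto i≤ = x , m<n⇒m<1+n x< , trans (L.old x<) e
    hi-onto′ : ∀ {i} → i ≤ ℓ → ∃ λ x → x < suc (suc k) × hi′ x ≡ i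
    hi-onto′ i≤ with x , x< , e ← hi-onto i≤ = x , m<n⇒m<1+n x< , trans (H.old x<) e

  minima′ : LevelMinima (suc k) lo′
  minima′ = record { ascent⇒min = asc⇒ ; min⇒ascent = min⇒ }
    where
    asc⇒ : ∀ {x} → suc x < suc (suc k) → lo′ x < lo′ (suc x) →
      ∀ {y} → y < suc (suc k) → lo′ y ≡ lo′ (suc x) → suc x ≤ y
    asc⇒ {x} x< lt {y} y< e with m<1+n⇒m<n∨m≡n x<
    ... | inj₂ refl rewrite L.new | L.old (n<1+n k) = ⊥-elim (<⇒≱ lt a≤)
    ... | inj₁ x<′ with m<1+n⇒m<n∨m≡n y<
    ...   | inj₂ refl = <⇒≤ x<′
    ...   | inj₁ y<′ rewrite L.old x<′ | L.old (<⇒≤ x<′) | L.old y<′ = ascent⇒min x<′ lt y<′ e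
    min⇒ : ∀ {x} → suc x < suc (suc k) → lo′ (suc x) ≤ lo′ x →
      ∃ λ y → y < suc x × lo′ y ≡ lo′ (suc x)
    min⇒ {x} x< le with m<1+n⇒m<n∨m≡n x<
    ... | inj₂ refl with y , y< , e ← lo-onto a≤ℓ = y , y< , trans (L.old y<) (trans e (sym L.new))
    ... | inj₁ x<′ rewrite L.old x<′ | L.old (<⇒≤ x<′) with y , y< , e ← min⇒ascent x<′ le =
      y , y< , trans (L.old (<-trans y< x<′)) e

  state : State (suc k) ℓ lo′ hi′
  state = record { intervals = intervals′ ; minima = minima′ ; last-hi = H.new ; last-low = low }
    where
    low : ∀ {x} → x < suc (suc k) → hi′ x ≡ ℓ → lo′ (suc k) ≤ lo′ x
    low x< e with m<1+n⇒m<n∨m≡n x<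
    ... | inj₁ x<′ rewrite L.old x<′ | H.old x<′ | L.new = ≤-trans a≤ (last-low x<′ e)
    ... | inj₂ refl = ≤-refl

  dichotomy : Dichotomy k ℓ lo hi → Dichotomy (suc k) ℓ lo′ hi′
  dichotomy (inj₁ R) = inj₁ record { ordered = ord ; diagonal = diag }
    where
    open Restricted R
    ord : Ordered (suc k) lo′ hi′
    ord {x} {y} x<y y< with m<1+n⇒m<n∨m≡n y<
    ... | inj₁ y<′ rewrite L.old y<′ | H.old y<′ | L.old (<-trans x<y y<′) | H.old (<-trans x<y y<′) =
      ordered x<y y<′
    ... | inj₂ refl rewrite L.new | H.new | L.old x<y | H.old x<y with m≤n⇒m<n∨m≡n (hi≤ℓ x<y)
    ...   | inj₁ lt = inj₁ lt
    -- Here x is maximal, so `last-low` puts it at or above the level of k, hence at or above a.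
    ...   | inj₂ e  = inj₂ (e , ≤-trans a≤ (last-low x<y e))
    diag : FullDiagonal (suc k) ℓ lo′ hi′
    diag d≤ with x , x< , p , q ← diagonal d≤ = x , m<n⇒m<1+n x< , trans (L.old x<) p , trans (H.old x<) q
  dichotomy (inj₂ U) = inj₂ record
    { bad = bad231-mono (λ x< y< → subst₂ _<_ (sym (L.old x<)) (sym (L.old y<))) bad
    ; gap = gap′ gap }
    where
    open Unrestricted U
    gap′ : DiagonalGap k ℓ lo hi → DiagonalGap (suc k) ℓ lo′ hi′
    gap′ (d , d≤ , none) = d , d≤ , none′
      where
      none′ : ∀ {x} → x < suc (suc k) → lo′ x ≡ d → hi′ x ≢ d
      none′ x< e₁ e₂ with m<1+n⇒m<n∨m≡n x<
      ... | inj₁ x<′ rewrite L.old x<′ | H.old x<′ = none x<′ e₁ e₂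
      -- The new interval [a , ℓ] could fill the gap only if d = ℓ, but an old element of level ℓ
      -- already is [ℓ , ℓ].
      ... | inj₂ refl rewrite L.new | H.new with refl ← e₂ with x , x<′ , e ← lo-onto ≤-refl =
        none x<′ e (≤-antisym (hi≤ℓ x<′) (subst (_≤ hi x) e (lo≤hi x<′)))

  module _ {r} (rep : IntervalOrder k r lo hi) where
    open IntervalFacts intervals rep

    case1 : (a ≤ᵇ ellStar P) ≡ true
    case1 rewrite ellStar≡ last-hi last-low = reflects-true (≤ᵇ-reflects-≤ a (lo k)) a≤

    order : IntervalOrder (suc k) (rel (stepAP a P)) lo′ hi′
    order {x} {y} x< y< with m<1+n⇒m<n∨m≡n x<
    ... | inj₂ refl rewrite stepAP-top a P y< | H.new = ofⁿ (≤⇒≯ (Intervals.lo≤ℓ intervals′ y<))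
    ... | inj₁ x<′ with m<1+n⇒m<n∨m≡n y<
    ...   | inj₁ y<′ rewrite stepAP-old a P x<′ y<′ | case1 | ∨-identityʳ (r x y) | H.old x<′ | L.old y<′ =
      rep x<′ y<′
    ...   | inj₂ refl rewrite stepAP-new a P x<′ | case1 | H.old x<′ | L.new = inD-reflects a≤ℓ x<′

-- Both ascending cases give the new element a level a of its own; this is their common part. For a
-- = ℓ + 1 the lift moves no existing level.
module NewLevel {k ℓ lo hi} (S : State k ℓ lo hi) {a} (a> : lo k < a) (a≤ : a ≤ suc ℓ)
  {lo′} (L : Extends k (λ x → lift a (lo x)) a lo′) where
  open State S
  module L = Extends L

  lo′-onto : ∀ {i} → i ≤ suc ℓ → ∃ λ x → x < suc (suc k) × lo′ x ≡ i
  lo′-onto {i} i≤ with <-cmp i a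
  ... | tri< i<a _ _ with x , x< , refl ← lo-onto (s≤s⁻¹ (<-≤-trans i<a a≤)) =
    x , m<n⇒m<1+n x< , trans (L.old x<) (lift-< i<a)
  ... | tri≈ _ refl _ = suc k , n<1+n (suc k) , L.new
  lo′-onto {suc i} i≤ | tri> _ _ i>a with x , x< , refl ← lo-onto (s≤s⁻¹ i≤) =
    x , m<n⇒m<1+n x< , trans (L.old x<) (lift-≥ (s≤s⁻¹ i>a))

  lo′-mono : ∀ {x y} → x < suc k → y < suc k → lo x < lo y → lo′ x < lo′ y
  lo′-mono x< y< lt rewrite L.old x< | L.old y< = lift-mono-< a lt

  lo′≢a : ∀ {x} → x < suc k → lo′ x ≢ a
  lo′≢a x< e = lift≢ a _ (trans (sym (L.old x<)) e)

  minima′ : LevelMinima (suc k) lo′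
  minima′ = record { ascent⇒min = asc⇒ ; min⇒ascent = min⇒ }
    where
    asc⇒ : ∀ {x} → suc x < suc (suc k) → lo′ x < lo′ (suc x) →
      ∀ {y} → y < suc (suc k) → lo′ y ≡ lo′ (suc x) → suc x ≤ y
    asc⇒ {x} x< lt {y} y< e with m<1+n⇒m<n∨m≡n x< | m<1+n⇒m<n∨m≡n y<
    ... | inj₂ refl | inj₁ y<′ = ⊥-elim (lo′≢a y<′ (trans e L.new))
    ... | inj₂ refl | inj₂ refl = ≤-refl
    ... | inj₁ x<′  | inj₂ refl = <⇒≤ x<′
    ... | inj₁ x<′  | inj₁ y<′ rewrite L.old x<′ | L.old (<⇒≤ x<′) | L.old y<′ =
      ascent⇒min x<′ (lift-cancel-< a lt) y<′ (lift-injective a e)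
    min⇒ : ∀ {x} → suc x < suc (suc k) → lo′ (suc x) ≤ lo′ x →
      ∃ λ y → y < suc x × lo′ y ≡ lo′ (suc x)
    min⇒ {x} x< le with m<1+n⇒m<n∨m≡n x<
    ... | inj₂ refl rewrite L.new | L.old (n<1+n k) | lift-< a> = ⊥-elim (<⇒≱ a> le)
    ... | inj₁ x<′ rewrite L.old x<′ | L.old (<⇒≤ x<′)
      with y , y< , e ← min⇒ascent x<′ (lift-cancel-≤ a le) =
      y , y< , trans (L.old (<-trans y< x<′)) (cong (lift a) e)

  module _ {r} (rep : IntervalOrder k r lo hi) where
    open IntervalFacts intervals rep

    ¬case1 : (a ≤ᵇ ellStar P) ≡ false
    ¬case1 rewrite ellStar≡ last-hi last-low = reflects-false (≤ᵇ-reflects-≤ a (lo k)) (<⇒≱ a>)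

module TopStep {k ℓ lo hi} (S : State k ℓ lo hi)
  {lo′ hi′} (L : Extends k (λ x → lift (suc ℓ) (lo x)) (suc ℓ) lo′) (H : Extends k hi (suc ℓ) hi′) where
  open State S
  a> : lo k < suc ℓ
  a> = s≤s (lo≤ℓ (n<1+n k))
  open NewLevel S a> ≤-refl L
  module H = Extends H

  lo-old : ∀ {x} → x < suc k → lo′ x ≡ lo x
  lo-old x< = trans (L.old x<) (lift-< (s≤s (lo≤ℓ x<)))

  intervals′ : Intervals (suc k) (suc ℓ) lo′ hi′
  intervals′ = record { lo≤hi = lo≤hi′ ; hi≤ℓ = hi≤ℓ′ ; lo-onto = lo′-onto ; hi-onto = hi-onto′ }
    where
    lo≤hi′ : ∀ {x} → x < suc (suc k) → lo′ x ≤ hi′ x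
    lo≤hi′ x< with m<1+n⇒m<n∨m≡n x<
    ... | inj₁ x<′ rewrite lo-old x<′ | H.old x<′ = lo≤hi x<′
    ... | inj₂ refl rewrite L.new | H.new = ≤-refl
    hi≤ℓ′ : ∀ {x} → x < suc (suc k) → hi′ x ≤ suc ℓ
    hi≤ℓ′ x< with m<1+n⇒m<n∨m≡n x<
    ... | inj₁ x<′ rewrite H.old x<′ = m≤n⇒m≤1+n (hi≤ℓ x<′)
    ... | inj₂ refl rewrite H.new = ≤-refl
    hi-onto′ : ∀ {i} → i ≤ suc ℓ → ∃ λ x → x < suc (suc k) × hi′ x ≡ i
    hi-onto′ i≤ with m≤n⇒m<n∨m≡n i≤
    ... | inj₁ (s≤s i≤ℓ) with x , x< , e ← hi-onto i≤ℓ = x , m<n⇒m<1+n x< , trans (H.old x<) e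
    ... | inj₂ refl = suc k , n<1+n (suc k) , H.new

  state : State (suc k) (suc ℓ) lo′ hi′
  state = record { intervals = intervals′ ; minima = minima′ ; last-hi = H.new ; last-low = low }
    where
    low : ∀ {x} → x < suc (suc k) → hi′ x ≡ suc ℓ → lo′ (suc k) ≤ lo′ x
    low x< e with m<1+n⇒m<n∨m≡n x<
    ... | inj₁ x<′ rewrite H.old x<′ = ⊥-elim (<⇒≢ (s≤s (hi≤ℓ x<′)) e)
    ... | inj₂ refl = ≤-refl

  dichotomy : Dichotomy k ℓ lo hi → Dichotomy (suc k) (suc ℓ) lo′ hi′
  dichotomy (inj₁ R) = inj₁ record { ordered = ord ; diagonal = diag }
    where
    open Restricted R
    ord : Ordered (suc k) lo′ hi′
    ord {x} {y} x<y y< with m<1+n⇒m<n∨m≡n y<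
    ... | inj₁ y<′ rewrite lo-old y<′ | H.old y<′ | lo-old (<-trans x<y y<′) | H.old (<-trans x<y y<′) =
      ordered x<y y<′
    ... | inj₂ refl rewrite H.new | H.old x<y = inj₁ (s≤s (hi≤ℓ x<y))
    diag : FullDiagonal (suc k) (suc ℓ) lo′ hi′
    diag d≤ with m≤n⇒m<n∨m≡n d≤
    ... | inj₂ refl = suc k , n<1+n (suc k) , L.new , H.new
    ... | inj₁ (s≤s d≤ℓ) with x , x< , p , q ← diagonal d≤ℓ =
      x , m<n⇒m<1+n x< , trans (lo-old x<) p , trans (H.old x<) q
  dichotomy (inj₂ U) = inj₂ record { bad = bad231-mono lo′-mono bad ; gap = gap′ gap }
    where
    open Unrestricted U
    gap′ : DiagonalGap k ℓ lo hi → DiagonalGap (suc k) (suc ℓ) lo′ hi′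
    gap′ (d , d≤ , none) = d , m≤n⇒m≤1+n d≤ , none′
      where
      none′ : ∀ {x} → x < suc (suc k) → lo′ x ≡ d → hi′ x ≢ d
      none′ x< e₁ e₂ with m<1+n⇒m<n∨m≡n x<
      ... | inj₁ x<′ rewrite lo-old x<′ | H.old x<′ = none x<′ e₁ e₂
      ... | inj₂ refl rewrite L.new with refl ← e₁ = <⇒≱ (n<1+n ℓ) d≤

  module _ {r} (rep : IntervalOrder k r lo hi) where
    open IntervalFacts intervals rep

    ¬case3 : (suc ℓ ≤ᵇ ell P) ≡ false
    ¬case3 rewrite ell≡ℓ = reflects-false (≤ᵇ-reflects-≤ (suc ℓ) ℓ) (<⇒≱ (n<1+n ℓ))

    order : IntervalOrder (suc k) (rel (stepAP (suc ℓ) P)) lo′ hi′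
    order {x} {y} x< y< with m<1+n⇒m<n∨m≡n x<
    ... | inj₂ refl rewrite stepAP-top (suc ℓ) P y< | H.new = ofⁿ (≤⇒≯ (Intervals.lo≤ℓ intervals′ y<))
    ... | inj₁ x<′ with m<1+n⇒m<n∨m≡n y<
    ...   | inj₁ y<′ rewrite stepAP-old (suc ℓ) P x<′ y<′ | ¬case1 rep | ¬case3 | ∨-identityʳ (r x y)
                           | H.old x<′ | lo-old y<′ =
      rep x<′ y<′
    ...   | inj₂ refl rewrite stepAP-new (suc ℓ) P x<′ | ¬case1 rep | ¬case3 | H.old x<′ | L.new =
      ofʸ (s≤s (hi≤ℓ x<′))

-- A maximal element x with lo x < a comes to lie below the old elements of
-- levels ≥ a, now raised by one, but not below the new element of level a.
splitHi : ℕ → ℕ → (ℕ → ℕ) → (ℕ → ℕ) → ℕ → ℕ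
splitHi ℓ a lo hi x = if (hi x ≡ᵇ ℓ) ∧ (lo x <ᵇ a) then a else lift a (hi x)

module SplitStep {k ℓ lo hi} (S : State k ℓ lo hi) {a} (a> : lo k < a) (a≤ : a ≤ ℓ)
  {lo′ hi′} (L : Extends k (λ x → lift a (lo x)) a lo′) (H : Extends k (splitHi ℓ a lo hi) (suc ℓ) hi′) where
  open State S
  open NewLevel S a> (m≤n⇒m≤1+n a≤) L
  module H = Extends H

  hi-old : ∀ {x} → x < suc k →
    (hi x ≡ ℓ × lo x < a × hi′ x ≡ a) ⊎ (¬ (hi x ≡ ℓ × lo x < a) × hi′ x ≡ lift a (hi x))
  hi-old {x} x< rewrite H.old x<
    with (hi x ≡ᵇ ℓ) ∧ (lo x <ᵇ a) | ≡ᵇ-reflects-≡ (hi x) ℓ ×-reflects <ᵇ-reflects-< (lo x) a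
  ... | true  | ofʸ (e , lt) = inj₁ (e , lt , refl)
  ... | false | ofⁿ ¬p       = inj₂ (¬p , refl)

  intervals′ : Intervals (suc k) (suc ℓ) lo′ hi′
  intervals′ = record { lo≤hi = lo≤hi′ ; hi≤ℓ = hi≤ℓ′ ; lo-onto = lo′-onto ; hi-onto = hi-onto′ }
    where
    lo≤hi′ : ∀ {x} → x < suc (suc k) → lo′ x ≤ hi′ x
    lo≤hi′ x< with m<1+n⇒m<n∨m≡n x<
    ... | inj₂ refl rewrite L.new | H.new = m≤n⇒m≤1+n a≤
    ... | inj₁ x<′ with hi-old x<′
    ...   | inj₁ (_ , lt , e) rewrite L.old x<′ | e | lift-< lt = <⇒≤ lt
    ...   | inj₂ (_ , e) rewrite L.old x<′ | e = lift-mono-≤ a (lo≤hi x<′)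
    hi≤ℓ′ : ∀ {x} → x < suc (suc k) → hi′ x ≤ suc ℓ
    hi≤ℓ′ x< with m<1+n⇒m<n∨m≡n x<
    ... | inj₂ refl rewrite H.new = ≤-refl
    ... | inj₁ x<′ with hi-old x<′
    ...   | inj₁ (_ , _ , e) rewrite e = m≤n⇒m≤1+n a≤
    ...   | inj₂ (_ , e) rewrite e = ≤-trans (lift-bound a _) (s≤s (hi≤ℓ x<′))
    hi-onto′ : ∀ {i} → i ≤ suc ℓ → ∃ λ x → x < suc (suc k) × hi′ x ≡ i
    hi-onto′ {i} i≤ with <-cmp i a
    -- `lift` skips the value a, but k is maximal with lo k < a, so `splitHi` sets its upper
    -- endpoint to a.
    ... | tri≈ _ refl _ with hi-old (n<1+n k)
    ...   | inj₁ (_ , _ , e) = k , m<n⇒m<1+n (n<1+n k) , e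
    ...   | inj₂ (¬p , _) = ⊥-elim (¬p (last-hi , a>))
    hi-onto′ {i} i≤ | tri< i<a _ _ with x , x< , refl ← hi-onto (≤-trans (<⇒≤ i<a) a≤) with hi-old x<
    ...   | inj₁ (refl , _) = ⊥-elim (<⇒≱ i<a a≤)
    ...   | inj₂ (_ , e) = x , m<n⇒m<1+n x< , trans e (lift-< i<a)
    hi-onto′ {suc i} i≤ | tri> _ _ i>a with m≤n⇒m<n∨m≡n (s≤s⁻¹ i≤)
    ...   | inj₂ refl = suc k , n<1+n (suc k) , H.new
    ...   | inj₁ i<ℓ with x , x< , refl ← hi-onto (<⇒≤ i<ℓ) with hi-old x<
    ...     | inj₁ (e , _) = ⊥-elim (<⇒≢ i<ℓ e)
    ...     | inj₂ (_ , e) = x , m<n⇒m<1+n x< , trans e (lift-≥ (s≤s⁻¹ i>a))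

  state : State (suc k) (suc ℓ) lo′ hi′
  state = record { intervals = intervals′ ; minima = minima′ ; last-hi = H.new ; last-low = low }
    where
    low : ∀ {x} → x < suc (suc k) → hi′ x ≡ suc ℓ → lo′ (suc k) ≤ lo′ x
    low {x} x< e with m<1+n⇒m<n∨m≡n x<
    ... | inj₂ refl = ≤-refl
    ... | inj₁ x<′ with hi-old x<′
    ...   | inj₁ (_ , _ , e′) = ⊥-elim (<⇒≢ (s≤s a≤) (trans (sym e′) e))
    ...   | inj₂ (¬p , e′) rewrite L.new | L.old x<′ with a ≤? lo x
    ...     | yes a≤lo = ≤-trans a≤lo (lift-inflate a _)
    ...     | no a≰lo = ⊥-elim (¬p (≤-antisym (hi≤ℓ x<′) (s≤s⁻¹ ℓ< ) , ≰⇒> a≰lo))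
      where
      ℓ< : suc ℓ ≤ suc (hi x)
      ℓ< = ≤-trans (≤-reflexive (trans (sym e) e′)) (lift-bound a (hi x))

  -- The elements k, k + 1 and an old y of level a, now lifted to a + 1, form the `Bad231`. Level a
  -- holds only the new interval [a , ℓ + 1], which is not a point as a ≤ ℓ.
  dichotomy : Dichotomy (suc k) (suc ℓ) lo′ hi′
  dichotomy = inj₂ record { bad = bad ; gap = a , m≤n⇒m≤1+n a≤ , gap }
    where
    bad : Bad231 (suc k) lo′
    bad with y , y< , e ← lo-onto a≤ with m<1+n⇒m<n∨m≡n y<
    ... | inj₂ refl = ⊥-elim (<⇒≢ a> e)
    ... | inj₁ y<k = k , y , n<1+n (suc k) , y<k ,
      subst₂ _<_ (sym (trans (L.old (n<1+n k)) (lift-< a>))) (sym L.new) a> ,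
      subst₂ _<_ (sym L.new) (sym (trans (L.old y<) (lift-≥ (≤-reflexive (sym e))))) (s≤s (≤-reflexive (sym e)))
    gap : ∀ {x} → x < suc (suc k) → lo′ x ≡ a → hi′ x ≢ a
    gap x< e₁ e₂ with m<1+n⇒m<n∨m≡n x<
    ... | inj₁ x<′ = lo′≢a x<′ e₁
    ... | inj₂ refl = <⇒≢ (s≤s a≤) (trans (sym e₂) H.new)

  module _ {r} (rep : IntervalOrder k r lo hi) where
    open IntervalFacts intervals rep

    case3 : (a ≤ᵇ ell P) ≡ true
    case3 rewrite ell≡ℓ = reflects-true (≤ᵇ-reflects-≤ a ℓ) a≤

    order : IntervalOrder (suc k) (rel (stepAP a P)) lo′ hi′
    order {x} {y} x< y< with m<1+n⇒m<n∨m≡n x<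
    ... | inj₂ refl rewrite stepAP-top a P y< | H.new = ofⁿ (≤⇒≯ (Intervals.lo≤ℓ intervals′ y<))
    ... | inj₁ x<′ with m<1+n⇒m<n∨m≡n y<
    ...   | inj₂ refl rewrite stepAP-new a P x<′ | ¬case1 rep | case3 | L.new =
      reflects-map to from (inD-reflects a≤ x<′)
      where
      to : hi x < a → hi′ x < a
      to lt with hi-old x<′
      ... | inj₁ (refl , _) = ⊥-elim (<⇒≱ lt a≤)
      ... | inj₂ (_ , e) rewrite e | lift-< lt = lt
      from : hi′ x < a → hi x < a
      from lt with hi-old x<′
      ... | inj₁ (_ , _ , e) = ⊥-elim (<⇒≢ lt e)
      ... | inj₂ (_ , e) rewrite e = ≤-<-trans (lift-inflate a _) lt
    ...   | inj₁ y<′ rewrite stepAP-old a P x<′ y<′ | ¬case1 rep | case3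
                           | level≡lo x<′ | level≡lo y<′ | L.old y<′ =
      reflects-map to from (rep x<′ y<′ ⊎-reflects (isMax-reflects x<′ ×-reflects
        (<ᵇ-reflects-< (lo x) a ×-reflects ≤ᵇ-reflects-≤ a (lo y))))
      where
      to : hi x < lo y ⊎ (hi x ≡ ℓ × lo x < a × a ≤ lo y) → hi′ x < lift a (lo y)
      to p with hi-old x<′ | p
      ... | inj₁ (refl , _) | inj₁ lt = ⊥-elim (<⇒≱ lt (lo≤ℓ y<′))
      ... | inj₁ (_ , _ , e) | inj₂ (_ , _ , a≤y) rewrite e | lift-≥ a≤y = s≤s a≤y
      ... | inj₂ (_ , e) | inj₁ lt rewrite e = lift-mono-< a lt
      ... | inj₂ (¬p , e) | inj₂ (q , q′ , _) = ⊥-elim (¬p (q , q′))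
      from : hi′ x < lift a (lo y) → hi x < lo y ⊎ (hi x ≡ ℓ × lo x < a × a ≤ lo y)
      from lt with hi-old x<′
      ... | inj₁ (p , q , e) = inj₂ (p , q , s≤s⁻¹ (≤-trans (subst (_< lift a (lo y)) e lt) (lift-bound a (lo y))))
      ... | inj₂ (_ , e) rewrite e = inj₁ (lift-cancel-< a lt)

-- Active sites of permutations

-- `activeSites π` computes to 0 followed by this list, because site 0 is always active.
nonzeroSites : List ℕ → List ℕ
nonzeroSites π = filterᵇ (activeSite π) (applyUpTo suc (length π))

mutual
  siteGo : ℕ → ℕ → List ℕ → List ℕ → ℕ → ℕ
  siteGo = _

  stepAS-unfold : ∀ k a π →
    stepAS k (suc a) π ≡ insertAt (siteGo k (suc a) π (nonzeroSites π) a) k π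
  stepAS-unfold k a π with nonzeroSites π
  ... | ss with suc a
  ...   | b = refl

siteGo≡nth : ∀ k b π ss a → siteGo k b π ss a ≡ nth (length π) ss a
siteGo≡nth k b π []       a       = refl
siteGo≡nth k b π (s ∷ ss) zero    = refl
siteGo≡nth k b π (s ∷ ss) (suc a) = siteGo≡nth k b π ss a

stepAS≡insertAt : ∀ k a π → stepAS k a π ≡ insertAt (nth (length π) (activeSites π) a) k π
stepAS≡insertAt k zero    π = refl
stepAS≡insertAt k (suc a) π = trans (stepAS-unfold k a π)
  (cong (λ s → insertAt s k π) (siteGo≡nth k (suc a) π (nonzeroSites π) a))

∈-drop⇒at : ∀ {xs x} s → x ∈ drop s xs → ∃ λ i → s ≤ i × i < length xs × at xs i ≡ x
∈-drop⇒at zero x∈ with i , i< , e ← ∈-at x∈ = i , z≤n , i< , e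
∈-drop⇒at {_ ∷ _} (suc s) x∈ with i , s≤i , i< , e ← ∈-drop⇒at s x∈ = suc i , s≤s s≤i , s≤s i< , e

AllPairs-map-∈ : {A : Set} {R S : A → A → Set} → ∀ {xs} →
  (∀ {x y} → x ∈ xs → y ∈ xs → R x y → S x y) → AllPairs R xs → AllPairs S xs
AllPairs-map-∈ f [] = []
AllPairs-map-∈ f (r ∷ rs) =
  All.tabulate (λ y∈ → f (here refl) (there y∈) (All.lookup r y∈)) ∷
  AllPairs-map-∈ (λ x∈ y∈ → f (there x∈) (there y∈)) rs

AllPairs-take-drop : {A : Set} {R : A → A → Set} → ∀ {xs} n → AllPairs R xs →
  All (λ x → All (R x) (drop n xs)) (take n xs)
AllPairs-take-drop zero    _        = []
AllPairs-take-drop (suc n) []       = []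
AllPairs-take-drop (suc n) (r ∷ rs) = All.drop⁺ n r ∷ AllPairs-take-drop n rs

-- The arguments are labels; `pred` recovers the element.
Before : (ℕ → ℕ) → ℕ → ℕ → Set
Before lo u v = lo (pred u) < lo (pred v) ⊎ (lo (pred u) ≡ lo (pred v) × v < u)

Before-asym : ∀ {lo u v} → Before lo u v → ¬ Before lo v u
Before-asym (inj₁ lt)       (inj₁ gt)       = <-asym lt gt
Before-asym (inj₁ lt)       (inj₂ (e , _))  = <-irrefl (sym e) lt
Before-asym (inj₂ (e , _))  (inj₁ gt)       = <-irrefl (sym e) gt
Before-asym (inj₂ (_ , lt)) (inj₂ (_ , gt)) = <-asym lt gt

Before⇒≤ : ∀ lo {u v} → Before lo u v → lo (pred u) ≤ lo (pred v)
Before⇒≤ lo (inj₁ lt)      = <⇒≤ lt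
Before⇒≤ lo (inj₂ (e , _)) = ≤-reflexive e

-- π lists the labels level by level, each level in decreasing order; the
-- element x of the poset carries the label x + 1.
record Reading (k : ℕ) (lo : ℕ → ℕ) (π : List ℕ) : Set where
  field
    sorted : AllPairs (Before lo) π
    perm   : IsPerm (suc k) π

  length≡ : length π ≡ suc k
  length≡ = trans (↭-length perm) (trans (length-map suc (upTo (suc k))) (length-upTo (suc k)))

  ∈⇒label : ∀ {u} → u ∈ π → ∃ λ x → x < suc k × u ≡ suc x
  ∈⇒label u∈ with x , x∈ , e ← ∈-map⁻ suc (∈-resp-↭ perm u∈) = x , ∈-upTo⁻ x∈ , e

  label⇒∈ : ∀ {x} → x < suc k → suc x ∈ π
  label⇒∈ x< = ∈-resp-↭ (↭-sym perm) (∈-map⁺ suc (∈-upTo⁺ x<))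

  position : ∀ {x} → x < suc k → ∃ λ i → i < length π × at π i ≡ suc x
  position x< = ∈-at (label⇒∈ x<)

  label : ∀ {i} → i < length π → ∃ λ x → x < suc k × at π i ≡ suc x
  label i< = ∈⇒label (at-∈ i<)

  w : ℕ → ℕ
  w i = lo (pred (at π i))

  w-mono : ∀ {i j} → i ≤ j → j < length π → w i ≤ w j
  w-mono i≤j j< with m≤n⇒m<n∨m≡n i≤j
  ... | inj₁ i<j  = Before⇒≤ lo (AllPairs-at sorted i<j j<)
  ... | inj₂ refl = ≤-refl

  Before⇒< : ∀ {i j} → i < length π → j < length π → Before lo (at π i) (at π j) → i < j
  Before⇒< {i} {j} i< j< b with <-cmp i j
  ... | tri< i<j _ _  = i<j
  ... | tri≈ _ refl _ = ⊥-elim (Before-asym {lo} b b)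
  ... | tri> _ _ j<i  = ⊥-elim (Before-asym {lo} b (AllPairs-at sorted j<i i<))

module Sites {k ℓ lo hi π} (S : State k ℓ lo hi) (R : Reading k lo π) where
  open State S
  open Reading R

  level-position : ∀ {v} → v ≤ ℓ → ∃ λ i → i < length π × w i ≡ v
  level-position v≤ with x , x< , e ← lo-onto v≤ with i , i< , q ← position x< =
    i , i< , trans (cong (lo ∘ pred) q) e

  w≤ℓ : ∀ {i} → i < length π → w i ≤ ℓ
  w≤ℓ i< with x , x< , e ← label i< rewrite e = lo≤ℓ x<

  -- A level is read in decreasing order, so its minimum is its last entry: before the right end,
  -- the entries followed by a rise of `w` are exactly the level minima.
  IsMin : ℕ → Set
  IsMin x = ∀ {y} → y < suc k → lo y ≡ lo x → x ≤ y

  min⇒w< : ∀ {j x} → suc j < length π → at π j ≡ suc x → IsMin x → w j < w (suc j)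
  min⇒w< {j} {x} j< e min with z , z< , e′ ← label j< | AllPairs-at sorted (n<1+n j) j<
  ... | inj₁ lt = lt
  ... | inj₂ (q , lt) rewrite e | e′ = ⊥-elim (<⇒≱ (s≤s⁻¹ lt) (min z< (sym q)))

  w<⇒min : ∀ {j x} → suc j < length π → at π j ≡ suc x → w j < w (suc j) → IsMin x
  w<⇒min {j} {x} j< e lt {y} y< q = ≮⇒≥ λ y<x → contra y<x (position y<)
    where
    contra : y < x → ¬ (∃ λ i → i < length π × at π i ≡ suc y)
    contra y<x (i , i< , e′) = <-irrefl w≡ (<-≤-trans lt (w-mono j<i i<))
      where
      w≡ : w j ≡ w i
      w≡ = trans (cong (lo ∘ pred) e) (trans (sym q) (sym (cong (lo ∘ pred) e′)))
      j<i : j < i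
      j<i = Before⇒< (<-trans (n<1+n j) j<) i< (inj₂ (w≡ , subst₂ _<_ (sym e′) (sym e) (s≤s y<x)))

  PredBefore : ℕ → Set
  PredBefore j = at π j ≡ 1 ⊎ (∃ λ u → u ∈ take j π × suc u ≡ at π j)

  -- When u stands left of u + 1, the tie case of `Before` is impossible, so `lo` ascends from one
  -- to the other and `ascent⇒min` applies. Label 1 is element 0, minimal in any level.
  predBefore⇒min : ∀ {j x} → j < length π → at π j ≡ suc x → x < suc k → PredBefore j → IsMin x
  predBefore⇒min j< e x< (inj₁ e₁) with refl ← suc-injective (trans (sym e) e₁) = λ _ _ → z≤n
  predBefore⇒min j< e x< (inj₂ (u , u∈ , q)) with i , i<j , i< , refl ← ∈-take⇒at u∈
    with z , z< , e′ ← label i< with refl ← suc-injective (trans (sym e) (sym q))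
    with AllPairs-at sorted i<j j<
  ... | inj₁ lt rewrite e | e′ = ascent⇒min x< lt
  ... | inj₂ (_ , gt) = ⊥-elim (<-asym gt (≤-reflexive q))

  min⇒predBefore : ∀ {j x} → j < length π → at π j ≡ suc x → x < suc k → IsMin x → PredBefore j
  min⇒predBefore {j} {zero} j< e x< min = inj₁ e
  min⇒predBefore {j} {suc x} j< e x< min with lo x <? lo (suc x)
  ... | no ≮ with y , y< , q ← min⇒ascent x< (≮⇒≥ ≮) = ⊥-elim (<⇒≱ y< (min (<-trans y< x<) q))
  ... | yes lt with i , i< , e′ ← position (<⇒≤ x<) =
    inj₂ (suc x , subst (_∈ take j π) e′ (at∈take i<j i<) , sym e)
    where
    i<j : i < j
    i<j = Before⇒< i< j< (inj₁ (subst₂ _<_ (sym (cong (lo ∘ pred) e′)) (sym (cong (lo ∘ pred) e)) lt))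

  activeSite-reflects : ∀ {j} → suc j < length π → Reflects (w j < w (suc j)) (activeSite π (suc j))
  activeSite-reflects {j} j< = reflects-map to from
    (≡ᵇ-reflects-≡ (suc j) (length π) ⊎-reflects (≡ᵇ-reflects-≡ (at π j) 1 ⊎-reflects
      any-reflects (take j π) λ {u} _ → ≡ᵇ-reflects-≡ (suc u) (at π j)))
    where
    j<′ : j < length π
    j<′ = <-trans (n<1+n j) j<
    to : suc j ≡ length π ⊎ PredBefore j → w j < w (suc j)
    to (inj₁ e) = ⊥-elim (<-irrefl e j<)
    to (inj₂ p) with x , x< , e ← label j<′ = min⇒w< j< e (predBefore⇒min j<′ e x< p)
    from : w j < w (suc j) → suc j ≡ length π ⊎ PredBefore j
    from lt with x , x< , e ← label j<′ = inj₂ (min⇒predBefore j<′ e x< (w<⇒min j< e lt))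

  w-step : ∀ {s} → suc s < length π → w (suc s) ≤ suc (w s)
  w-step {s} s< = ≮⇒≥ λ lt → contra lt (level-position (≤-trans (<⇒≤ lt) (w≤ℓ s<)))
    where
    contra : suc (w s) < w (suc s) → ¬ (∃ λ i → i < length π × w i ≡ suc (w s))
    contra lt (i , i< , e) with i ≤? s
    ... | yes i≤s = <⇒≱ (n<1+n (w s)) (subst (_≤ w s) e (w-mono i≤s (<-trans (n<1+n s) s<)))
    ... | no i≰s = <⇒≱ lt (subst (w (suc s) ≤_) e (w-mono (≰⇒> i≰s) i<))

  w0≡0 : w 0 ≡ 0
  w0≡0 with i , i< , e ← level-position z≤n = n≤0⇒n≡0 (subst (w 0 ≤_) e (w-mono z≤n i<))

  -- Site 0 contributes one, and each further active site marks a rise of `w` by exactly one.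
  count-active : ∀ s → s < length π → count (activeSite π) (suc s) ≡ suc (w s)
  count-active zero    s< = cong suc (sym w0≡0)
  count-active (suc s) s< = begin
    count p (suc (suc s))                                ≡⟨ count-suc p (suc s) ⟩
    count p (suc s) + (if p (suc s) then 1 else 0)       ≡⟨ cong (_+ (if p (suc s) then 1 else 0)) (count-active s (<-trans (n<1+n s) s<)) ⟩
    suc (w s) + (if p (suc s) then 1 else 0)             ≡⟨ increment ⟩
    suc (w (suc s))                                      ∎
    where
    open ≡-Reasoning
    p = activeSite π
    increment : suc (w s) + (if p (suc s) then 1 else 0) ≡ suc (w (suc s))
    increment with p (suc s) | activeSite-reflects s<
    ... | true  | ofʸ lt = trans (+-comm (suc (w s)) 1) (cong suc (≤-antisym lt (w-step s<)))
    ... | false | ofⁿ ≮  = trans (+-identityʳ _) (cong suc (≤-antisym (w-mono (n≤1+n s) s<) (≮⇒≥ ≮)))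

  record Cut (a n s : ℕ) : Set where
    field
      s≤n : s ≤ n
      below : ∀ {i} → i < s → w i < a
      above : ∀ {i} → s ≤ i → i < n → a ≤ w i

  cut : ∀ a n → n ≤ length π → ∃ (Cut a n)
  cut a zero n≤ = 0 , record { s≤n = z≤n ; below = λ () ; above = λ _ () }
  cut a (suc n) n≤ with w n <? a
  ... | yes lt = suc n , record
    { s≤n = ≤-refl
    ; below = λ i< → ≤-<-trans (w-mono (s≤s⁻¹ i<) n≤) lt
    ; above = λ n<i i≤n → ⊥-elim (<⇒≱ n<i (s≤s⁻¹ i≤n)) }
  ... | no ≮ with s , c ← cut a n (<⇒≤ n≤) = s , record
    { s≤n = m≤n⇒m≤1+n (Cut.s≤n c) ; below = Cut.below c ; above = above }
    where
    above : ∀ {i} → s ≤ i → i < suc n → a ≤ w i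
    above s≤i i< with m<1+n⇒m<n∨m≡n i<
    ... | inj₁ i<n  = Cut.above c s≤i i<n
    ... | inj₂ refl = ≮⇒≥ ≮

  -- The cut is the left end for a = 0, the right end for a = ℓ + 1, and otherwise the place where
  -- `w` rises to a. As `w` skips no value, exactly a active sites precede it.
  active-cut : ∀ {a s} → a ≤ suc ℓ → Cut a (length π) s →
    activeSite π s ≡ true × count (activeSite π) s ≡ a
  active-cut {a} {zero} a≤ c = refl , sym (n≤0⇒n≡0 (subst (a ≤_) w0≡0 (Cut.above c z≤n 0<)))
    where
    0< : 0 < length π
    0< = subst (0 <_) (sym length≡) z<s
  active-cut {a} {suc t} a≤ c = active , trans (count-active t (Cut.s≤n c)) (≤-antisym wt<a (≮⇒≥ gap))
    where
    wt<a : w t < a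
    wt<a = Cut.below c (n<1+n t)
    active : activeSite π (suc t) ≡ true
    active with m≤n⇒m<n∨m≡n (Cut.s≤n c)
    ... | inj₁ t< = reflects-true (activeSite-reflects t<) (<-≤-trans wt<a (Cut.above c ≤-refl t<))
    ... | inj₂ e rewrite reflects-true (≡ᵇ-reflects-≡ (suc t) (length π)) e = refl
    gap : ¬ (suc (w t) < a)
    gap lt with i , i< , e ← level-position (s≤s⁻¹ (≤-trans lt a≤)) with i ≤? t
    ... | yes i≤t = <⇒≱ (n<1+n (w t)) (subst (_≤ w t) e (w-mono i≤t (Cut.s≤n c)))
    ... | no i≰t = <⇒≱ lt (subst (a ≤_) e (Cut.above c (≰⇒> i≰t) i<))

  stepAS-cut : ∀ {a s} v → a ≤ suc ℓ → Cut a (length π) s → stepAS v a π ≡ insertAt s v π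
  stepAS-cut {a} {s} v a≤ c with active , refl ← active-cut a≤ c =
    trans (stepAS≡insertAt v a π)
      (cong (λ t → insertAt t v π) (nth-filterᵇ (length π) (activeSite π) id (s≤s (Cut.s≤n c)) active))

  -- The new label is the largest, so it must come first in level a, which is at the cut. The
  -- conditions on `lo′` cover steps with and without lifting.
  reading-step : ∀ {a lo′} → a ≤ suc ℓ → lo′ (suc k) ≡ a →
    (∀ {x y} → x < suc k → y < suc k → lo x < lo y → lo′ x < lo′ y) →
    (∀ {x y} → x < suc k → y < suc k → lo x ≡ lo y → lo′ x ≡ lo′ y) →
    (∀ {x} → x < suc k → lo x < a → lo′ x < a) →
    (∀ {x} → x < suc k → a ≤ lo x → a ≤ lo′ x) →
    Reading (suc k) lo′ (stepAS (suc (suc k)) a π)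
  reading-step {a} {lo′} a≤ new mono cong′ below above with s , c ← cut a (length π) ≤-refl
    rewrite stepAS-cut (suc (suc k)) a≤ c = record
    { sorted = AllPairs.++⁺ (AllPairs.take⁺ s sorted′) (All.tabulate new-drop ∷ AllPairs.drop⁺ s sorted′)
        (All.zipWith (λ (p , q) → p ∷ q) (All.tabulate take-new , AllPairs-take-drop s sorted′))
    ; perm = begin
        take s π ++ suc (suc k) ∷ drop s π            ↭⟨ shift (suc (suc k)) (take s π) (drop s π) ⟩
        suc (suc k) ∷ take s π ++ drop s π            ≡⟨ cong (suc (suc k) ∷_) (take++drop≡id s π) ⟩
        suc (suc k) ∷ π                               ↭⟨ prep (suc (suc k)) perm ⟩
        suc (suc k) ∷ map suc (upTo (suc k))          ↭⟨ ∷↭∷ʳ (suc (suc k)) (map suc (upTo (suc k))) ⟩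
        map suc (upTo (suc k)) ++ [ suc (suc k) ]     ≡⟨ map-++ suc (upTo (suc k)) [ suc k ] ⟨
        map suc (upTo (suc k) ++ [ suc k ])           ≡⟨ cong (map suc) (upTo-∷ʳ (suc k)) ⟩
        map suc (upTo (suc (suc k)))                  ∎
    }
    where
    open PermutationReasoning
    sorted′ : AllPairs (Before lo′) π
    sorted′ = AllPairs-map-∈ conv sorted
      where
      conv : ∀ {u v} → u ∈ π → v ∈ π → Before lo u v → Before lo′ u v
      conv u∈ v∈ b with x , x< , refl ← ∈⇒label u∈ | y , y< , refl ← ∈⇒label v∈ | b
      ... | inj₁ lt       = inj₁ (mono x< y< lt)
      ... | inj₂ (e , lt) = inj₂ (cong′ x< y< e , lt)
    take-new : ∀ {u} → u ∈ take s π → Before lo′ u (suc (suc k))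
    take-new u∈ with i , i<s , i< , refl ← ∈-take⇒at u∈ with wi<a ← Cut.below c i<s
      with x , x< , e ← label i< rewrite e | new = inj₁ (below x< wi<a)
    new-drop : ∀ {u} → u ∈ drop s π → Before lo′ (suc (suc k)) u
    new-drop u∈ with i , s≤i , i< , refl ← ∈-drop⇒at s u∈ with a≤wi ← Cut.above c s≤i i<
      with x , x< , e ← label i< rewrite e | new with m≤n⇒m<n∨m≡n (above x< a≤wi)
    ... | inj₁ lt = inj₁ lt
    ... | inj₂ q  = inj₂ (q , s≤s x<)

-- Ascent sequences

runAP : List ℕ → FPoset → FPoset
runAP []       P = P
runAP (a ∷ as) P = runAP as (stepAP a P)

mutual
  goAP : ℕ → List ℕ → List ℕ → FPoset → FPoset
  goAP = _

  fAP-unfold : ∀ x y ys → fAP (x ∷ y ∷ ys) ≡ goAP x (y ∷ ys) ys (stepAP y (mkP 1 λ _ _ → false))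
  fAP-unfold x y ys with y ∷ ys | stepAP y (mkP 1 λ _ _ → false)
  ... | zs | Q = refl

goAP≡runAP : ∀ x zs as P → goAP x zs as P ≡ runAP as P
goAP≡runAP x zs []       P = refl
goAP≡runAP x zs (a ∷ as) P = goAP≡runAP x zs as (stepAP a P)

fAP≡runAP : ∀ x as → fAP (x ∷ as) ≡ runAP as (mkP 1 λ _ _ → false)
fAP≡runAP x []       = refl
fAP≡runAP x (y ∷ ys) = trans (fAP-unfold x y ys) (goAP≡runAP x (y ∷ ys) ys _)

runAS : ℕ → List ℕ → List ℕ → List ℕ
runAS k []       π = π
runAS k (a ∷ as) π = runAS (suc k) as (stepAS k a π)

mutual
  goAS : ℕ → List ℕ → ℕ → List ℕ → List ℕ → List ℕ
  goAS = _

  fAS-unfold : ∀ x y ys → fAS (x ∷ y ∷ ys) ≡ goAS x (y ∷ ys) 3 ys (stepAS 2 y (1 ∷ []))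
  fAS-unfold x y ys with 3 | y ∷ ys | stepAS 2 y (1 ∷ [])
  ... | k | zs | π = refl

goAS≡runAS : ∀ x zs k as π → goAS x zs k as π ≡ runAS k as π
goAS≡runAS x zs k []       π = refl
goAS≡runAS x zs k (a ∷ as) π = goAS≡runAS x zs (suc k) as (stepAS k a π)

fAS≡runAS : ∀ x as → fAS (x ∷ as) ≡ runAS 2 as (1 ∷ [])
fAS≡runAS x []       = refl
fAS≡runAS x (y ∷ ys) = trans (fAS-unfold x y ys) (goAS≡runAS x (y ∷ ys) 3 ys _)

-- The indices are the number of ascents and the last entry so far.
data Continuation : ℕ → ℕ → List ℕ → Set where
  []   : ∀ {ℓ last} → Continuation ℓ last []
  low  : ∀ {ℓ last a as} → a ≤ last → Continuation ℓ a as → Continuation ℓ last (a ∷ as)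
  high : ∀ {ℓ last a as} → last < a → a ≤ suc ℓ → Continuation (suc ℓ) a as → Continuation ℓ last (a ∷ as)

continuation : ∀ ℓ last as →
  (∀ i → i < length as → at as i ≤ suc (ℓ + asc (last ∷ take i as))) → Continuation ℓ last as
continuation ℓ last [] h = []
continuation ℓ last (a ∷ as) h with last <ᵇ a | <ᵇ-reflects-< last a | (λ i → h (suc i))
... | false | ofⁿ ≮  | h′ = low (≮⇒≥ ≮) (continuation ℓ a as λ i i< → h′ i (s≤s i<))
... | true  | ofʸ lt | h′ = high lt (subst (λ m → a ≤ suc m) (+-identityʳ ℓ) (h 0 z<s))
  (continuation (suc ℓ) a as λ i i< → subst (λ m → at as i ≤ suc m) (+-suc ℓ _) (h′ i (s≤s i<)))

-- The two maps are run in parallel: one function `lo` gives both the levels of the poset and the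
-- arrangement of the permutation.
record Built (P : FPoset) (π : List ℕ) : Set where
  field
    {k ℓ}     : ℕ
    {lo hi}   : ℕ → ℕ
    r         : ℕ → ℕ → Bool
    poset≡    : P ≡ mkP (suc k) r
    state     : State k ℓ lo hi
    order     : IntervalOrder k r lo hi
    reading   : Reading k lo π
    dichotomy : Dichotomy k ℓ lo hi

run : ∀ {k ℓ lo hi} r {π as} → State k ℓ lo hi → IntervalOrder k r lo hi → Reading k lo π →
  Dichotomy k ℓ lo hi → Continuation ℓ (lo k) as →
  Built (runAP as (mkP (suc k) r)) (runAS (suc (suc k)) as π)
run r S O R D [] = record
  { r = r ; poset≡ = refl ; state = S ; order = O ; reading = R ; dichotomy = D }
run {k} {ℓ} {lo} {hi} r {π} {a ∷ as} S O R D (low a≤ C) =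
  run _ state (order O) reading (dichotomy D) (subst (λ v → Continuation ℓ v as) (sym L.new) C)
  where
  lo′ = extend (suc k) lo a
  open LowStep S a≤ (extend-extends k lo a) (extend-extends k hi ℓ)
  reading : Reading (suc k) lo′ (stepAS (suc (suc k)) a π)
  reading = Sites.reading-step S R (m≤n⇒m≤1+n a≤ℓ) L.new
    (λ x< y< → subst₂ _<_ (sym (L.old x<)) (sym (L.old y<)))
    (λ x< y< → subst₂ _≡_ (sym (L.old x<)) (sym (L.old y<)))
    (λ x< → subst (_< a) (sym (L.old x<)))
    (λ x< → subst (a ≤_) (sym (L.old x<)))
run {k} {ℓ} {lo} {hi} r {π} {a ∷ as} S O R D (high a> a≤ C) = step (m≤n⇒m<n∨m≡n a≤)
  where
  lo′ = extend (suc k) (λ x → lift a (lo x)) a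
  L : Extends k (λ x → lift a (lo x)) a lo′
  L = extend-extends k (λ x → lift a (lo x)) a
  module L = Extends L
  reading : Reading (suc k) lo′ (stepAS (suc (suc k)) a π)
  reading = Sites.reading-step S R a≤ L.new
    (λ x< y< lt → subst₂ _<_ (sym (L.old x<)) (sym (L.old y<)) (lift-mono-< a lt))
    (λ x< y< e → subst₂ _≡_ (sym (L.old x<)) (sym (L.old y<)) (cong (lift a) e))
    (λ x< lt → subst (_< a) (sym (trans (L.old x<) (lift-< lt))) lt)
    (λ x< le → subst (a ≤_) (sym (L.old x<)) (≤-trans le (lift-inflate a _)))
  C′ : Continuation (suc ℓ) (lo′ (suc k)) as
  C′ = subst (λ v → Continuation (suc ℓ) v as) (sym L.new) C
  step : a < suc ℓ ⊎ a ≡ suc ℓ → Built (runAP as (stepAP a (mkP (suc k) r))) (runAS (suc (suc (suc k))) as (stepAS (suc (suc k)) a π))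
  step (inj₁ (s≤s a≤ℓ)) = run _ state (order O) reading dichotomy C′
    where open SplitStep S a> a≤ℓ L (extend-extends k (splitHi ℓ a lo hi) (suc ℓ))
  step (inj₂ refl) = run _ state (order O) reading (dichotomy D) C′
    where open TopStep S L (extend-extends k hi (suc ℓ))

built : ∀ c → IsAscent c → Built (fAP c) (fAS c)
built (x ∷ as) (_ , refl , bound) rewrite fAP≡runAP x as | fAS≡runAS x as =
  run (λ _ _ → false) state₀ (λ _ _ → ofⁿ λ ()) reading₀ (inj₁ restricted₀)
    (continuation 0 0 as λ i i< → bound (suc i) z<s (s≤s i<))
  where
  zeroLo : ℕ → ℕ
  zeroLo _ = 0
  x≤0 : ∀ {i} → i ≤ 0 → ∃ λ x → x < 1 × zeroLo x ≡ i
  x≤0 z≤n = 0 , z<s , refl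
  state₀ : State 0 0 zeroLo zeroLo
  state₀ = record
    { intervals = record { lo≤hi = λ _ → z≤n ; hi≤ℓ = λ _ → z≤n ; lo-onto = x≤0 ; hi-onto = x≤0 }
    ; minima = record { ascent⇒min = λ { (s≤s ()) } ; min⇒ascent = λ { (s≤s ()) } }
    ; last-hi = refl ; last-low = λ _ _ → z≤n }
  reading₀ : Reading 0 zeroLo (1 ∷ [])
  reading₀ = record { sorted = [] ∷ [] ; perm = ↭-refl }
  restricted₀ : Restricted 0 0 zeroLo zeroLo
  restricted₀ = record
    { ordered = λ { () (s≤s z≤n) } ; diagonal = λ { z≤n → 0 , z<s , refl , refl } }

avoids⇒¬bad : ∀ {k lo π} → Reading k lo π → Avoids31̄524̄ π → ¬ Bad231 k lo
avoids⇒¬bad {k} {lo} {π} R avoids (x , y , x< , y<x , p , q)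
  with i , i< , ei ← Reading.position R (<⇒≤ x<)
     | j , j< , ej ← Reading.position R x<
     | l , l< , el ← Reading.position R (<-trans y<x (<⇒≤ x<))
  with _ , _ , _ , _ , x<v , v<x ← avoids i j l
    (Reading.Before⇒< R i< j< (inj₁ (subst₂ (λ u v → lo (pred u) < lo (pred v)) (sym ei) (sym ej) p)))
    (Reading.Before⇒< R j< l< (inj₁ (subst₂ (λ u v → lo (pred u) < lo (pred v)) (sym ej) (sym el) q)))
    l< (subst₂ _<_ (sym el) (sym ei) (s≤s y<x)) (subst₂ _<_ (sym ei) (sym ej) (n<1+n (suc x)))
  rewrite ei | ej = <⇒≱ x<v (s≤s⁻¹ v<x)

-- An embedding can only raise the endpoints of minimal interval
-- representations; hence isomorphisms preserve them.
module Embedding {k ℓ lo hi r k′ ℓ′ lo′ hi′ r′}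
  (I : Intervals k ℓ lo hi) (O : IntervalOrder k r lo hi)
  (I′ : Intervals k′ ℓ′ lo′ hi′) (O′ : IntervalOrder k′ r′ lo′ hi′)
  (f : Fin (suc k) → Fin (suc k′)) (pres : ∀ x y → r (toℕ x) (toℕ y) ≡ r′ (toℕ (f x)) (toℕ (f y))) where
  open Intervals I

  reflects-image : ∀ x y → Reflects (hi′ (toℕ (f x)) < lo′ (toℕ (f y))) (r (toℕ x) (toℕ y))
  reflects-image x y rewrite pres x y = O′ (toℕ<n (f x)) (toℕ<n (f y))

  ≺⇒image : ∀ x y → hi (toℕ x) < lo (toℕ y) → hi′ (toℕ (f x)) < lo′ (toℕ (f y))
  ≺⇒image x y lt = reflects-T⁻ (reflects-image x y) (reflects-T⁺ (O (toℕ<n x) (toℕ<n y)) lt)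

  image⇒≺ : ∀ x y → hi′ (toℕ (f x)) < lo′ (toℕ (f y)) → hi (toℕ x) < lo (toℕ y)
  image⇒≺ x y lt = reflects-T⁻ (O (toℕ<n x) (toℕ<n y)) (reflects-T⁺ (reflects-image x y) lt)

  element : ∀ (g : ℕ → ℕ) {i} → (∃ λ x → x < suc k × g x ≡ i) → ∃ λ (x : Fin (suc k)) → g (toℕ x) ≡ i
  element g (x , x< , e) = fromℕ< x< , trans (cong g (toℕ-fromℕ< x<)) e

  -- An element z with hi z = lo y lies below x but not below y, and both facts pass to the images.
  lo<⇒image< : ∀ x y → lo (toℕ y) < lo (toℕ x) → lo′ (toℕ (f y)) < lo′ (toℕ (f x))
  lo<⇒image< x y lt with z , e ← element hi (hi-onto (lo≤ℓ (toℕ<n y))) =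
    ≤-<-trans (≮⇒≥ λ h → <-irrefl e (image⇒≺ z y h)) (≺⇒image z x (subst (_< lo (toℕ x)) (sym e) lt))

  -- Induction on the level: an element one level lower has a strictly lower image.
  lo≤image′ : ∀ v x → lo (toℕ x) ≡ v → v ≤ lo′ (toℕ (f x))
  lo≤image′ zero    x e = z≤n
  lo≤image′ (suc v) x e
    with y , e′ ← element lo (lo-onto (<⇒≤ (subst (_≤ ℓ) e (lo≤ℓ (toℕ<n x))))) =
    ≤-<-trans (lo≤image′ v y e′) (lo<⇒image< x y (subst₂ _<_ (sym e′) (sym e) (n<1+n v)))

  lo≤image : ∀ x → lo (toℕ x) ≤ lo′ (toℕ (f x))
  lo≤image x = lo≤image′ _ x refl

  -- An element y with lo y = hi x is not above x, so its image is not above the image of x.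
  hi≤image : ∀ x → hi (toℕ x) ≤ hi′ (toℕ (f x))
  hi≤image x with y , e ← element lo (lo-onto (hi≤ℓ (toℕ<n x))) = begin
    hi (toℕ x)       ≡⟨ e ⟨
    lo (toℕ y)       ≤⟨ lo≤image y ⟩
    lo′ (toℕ (f y))  ≤⟨ ≮⇒≥ (λ h → <-irrefl (sym e) (image⇒≺ x y h)) ⟩
    hi′ (toℕ (f x))  ∎
    where open ≤-Reasoning

  ℓ≤image : ℓ ≤ ℓ′
  ℓ≤image with x , e ← element lo (lo-onto ≤-refl) =
    subst (_≤ ℓ′) e (≤-trans (lo≤image x) (Intervals.lo≤ℓ I′ (toℕ<n (f x))))

module Isomorphism {k ℓ lo hi r k′ ℓ′ lo′ hi′ r′}
  (I : Intervals k ℓ lo hi) (O : IntervalOrder k r lo hi)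
  (I′ : Intervals k′ ℓ′ lo′ hi′) (O′ : IntervalOrder k′ r′ lo′ hi′)
  (iso : mkP (suc k) r ≅P mkP (suc k′) r′) where
  open Inverse (proj₁ iso) using (to; from; strictlyInverseˡ; strictlyInverseʳ)

  module E = Embedding I O I′ O′ to (proj₂ iso)
  module E⁻¹ = Embedding I′ O′ I O from (λ x y → sym (trans (proj₂ iso (from x) (from y))
    (cong₂ (λ u v → r′ (toℕ u) (toℕ v)) (strictlyInverseˡ x) (strictlyInverseˡ y))))

  ℓ≡ : ℓ ≡ ℓ′
  ℓ≡ = ≤-antisym E.ℓ≤image E⁻¹.ℓ≤image

  lo≡ : ∀ x → lo (toℕ x) ≡ lo′ (toℕ (to x))
  lo≡ x = ≤-antisym (E.lo≤image x)
    (≤-trans (E⁻¹.lo≤image (to x)) (≤-reflexive (cong (lo ∘ toℕ) (strictlyInverseʳ x))))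

  hi≡ : ∀ x → hi (toℕ x) ≡ hi′ (toℕ (to x))
  hi≡ x = ≤-antisym (E.hi≤image x)
    (≤-trans (E⁻¹.hi≤image (to x)) (≤-reflexive (cong (hi ∘ toℕ) (strictlyInverseʳ x))))

-- Reversal of interval representations

intervals-dual : ∀ {k ℓ lo hi} → Intervals k ℓ lo hi →
  Intervals k ℓ (λ x → ℓ ∸ hi x) (λ x → ℓ ∸ lo x)
intervals-dual {k} {ℓ} {lo} {hi} I = record
  { lo≤hi = λ x< → ∸-monoʳ-≤ ℓ (lo≤hi x<)
  ; hi≤ℓ = λ {x} _ → m∸n≤m ℓ (lo x)
  ; lo-onto = λ {i} i≤ → reflect i≤ (hi-onto (m∸n≤m ℓ i))
  ; hi-onto = λ {i} i≤ → reflect i≤ (lo-onto (m∸n≤m ℓ i)) }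
  where
  open Intervals I
  reflect : ∀ {g : ℕ → ℕ} {i} → i ≤ ℓ → (∃ λ x → x < suc k × g x ≡ ℓ ∸ i) → ∃ λ x → x < suc k × ℓ ∸ g x ≡ i
  reflect i≤ (x , x< , e) = x , x< , trans (cong (ℓ ∸_) e) (m∸[m∸n]≡n i≤)

order-dual : ∀ {k ℓ lo hi r} → Intervals k ℓ lo hi → IntervalOrder k r lo hi →
  IntervalOrder k (flip r) (λ x → ℓ ∸ hi x) (λ x → ℓ ∸ lo x)
order-dual I O x< y< = reflects-map
  (λ lt → ∸-monoʳ-< lt (Intervals.lo≤ℓ I x<)) ∸-cancelʳ-< (O y< x<)

map-bijection-↭ : ∀ {n} (f : Fin n ↔ Fin n) → map (toℕ ∘ Inverse.to f) (allFin n) ↭ upTo n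
map-bijection-↭ {n} f = unique-↭
  (Unique.map⁺ (λ e → Injection.injective (↔⇒↣ f) (toℕ-injective e)) (Unique.allFin⁺ n)) (Unique.upTo⁺ n) sound complete
  where
  open Inverse f using (to; from; strictlyInverseˡ)
  sound : ∀ {x} → x ∈ map (toℕ ∘ to) (allFin n) → x ∈ upTo n
  sound x∈ with y , _ , refl ← ∈-map⁻ (toℕ ∘ to) x∈ = ∈-upTo⁺ (toℕ<n (to y))
  complete : ∀ {x} → x ∈ upTo n → x ∈ map (toℕ ∘ to) (allFin n)
  complete x∈ with x< ← ∈-upTo⁻ x∈ = subst (_∈ map (toℕ ∘ to) (allFin n))
    (trans (cong toℕ (strictlyInverseˡ (fromℕ< x<))) (toℕ-fromℕ< x<))
    (∈-map⁺ (toℕ ∘ to) (∈-allFin (from (fromℕ< x<))))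

-- Duality

-- The order of the labels, on pairs (lo , hi).
_≼_ : ℕ × ℕ → ℕ × ℕ → Set
(l , h) ≼ (l′ , h′) = h < h′ ⊎ (h ≡ h′ × l′ ≤ l)

≼-antisym : ∀ {p q} → p ≼ q → q ≼ p → p ≡ q
≼-antisym (inj₁ lt)       (inj₁ gt)         = ⊥-elim (<-asym lt gt)
≼-antisym (inj₁ lt)       (inj₂ (e , _))    = ⊥-elim (<-irrefl (sym e) lt)
≼-antisym (inj₂ (e , _))  (inj₁ gt)         = ⊥-elim (<-irrefl (sym e) gt)
≼-antisym (inj₂ (e , le)) (inj₂ (_ , ge)) = cong₂ _,_ (≤-antisym ge le) e

module RevCompl {k ℓ lo hi π} (I : Intervals k ℓ lo hi) (R : Reading k lo π) (ord : Ordered k lo hi) where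
  open Intervals I
  open Reading R using (sorted; perm; label⇒∈; ∈⇒label) renaming (length≡ to length-π)

  n : ℕ
  n = suc k

  -- An entry r of ρ stands for the element n ∸ r: it comes from the label u = n + 1 - r of π, which
  -- belongs to the element u - 1.
  ρ : List ℕ
  ρ = compl n (rev π)

  length-ρ : length ρ ≡ n
  length-ρ = trans (length-map (suc n ∸_) (reverse π)) (trans (length-reverse π) length-π)

  value∈ρ : ∀ {i} → i < n → suc i ∈ ρ
  value∈ρ {i} i<n = subst (_∈ ρ) (m∸[m∸n]≡n i<n)
    (∈-map⁺ (suc n ∸_) (∈-resp-↭ (↭-sym (↭-reverse π)) (label⇒∈ (s≤s (m∸n≤m k i)))))

  ρ-value : ∀ {r} → r ∈ ρ → ∃ λ i → i < n × r ≡ suc i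
  ρ-value r∈ with u , u∈ , refl ← ∈-map⁻ (suc n ∸_) r∈
    with x , x< , refl ← ∈⇒label (∈-resp-↭ (↭-reverse π) u∈) =
    k ∸ x , s≤s (m∸n≤m k x) , +-∸-assoc 1 (s≤s⁻¹ x<)

  ρ-sorted : AllPairs (λ r s → Before lo (suc n ∸ s) (suc n ∸ r)) ρ
  ρ-sorted = AllPairs.map⁺ (AllPairs-map-∈ restore (AllPairs-reverse sorted))
    where
    involutive : ∀ {u} → u ∈ reverse π → suc n ∸ (suc n ∸ u) ≡ u
    involutive u∈ with x , x< , refl ← ∈⇒label (∈-resp-↭ (↭-reverse π) u∈) = m∸[m∸n]≡n (m≤n⇒m≤1+n x<)
    restore : ∀ {u v} → u ∈ reverse π → v ∈ reverse π → Before lo v u →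
      Before lo (suc n ∸ (suc n ∸ v)) (suc n ∸ (suc n ∸ u))
    restore u∈ v∈ = subst₂ (Before lo) (sym (involutive v∈)) (sym (involutive u∈))

  -- The endpoints of x in the reversed order.
  key : ℕ → ℕ × ℕ
  key x = ℓ ∸ hi x , ℓ ∸ lo x

  -- Reading π backwards, lo weakly falls, so the dual upper endpoint ℓ ∸ lo weakly rises. Within a
  -- level the labels now increase, and `ord` makes `hi` weakly increase, so ℓ ∸ hi weakly falls.
  ρ-keys-sorted : AllPairs _≼_ (map (λ r → key (n ∸ r)) ρ)
  ρ-keys-sorted = AllPairs.map⁺ (AllPairs-map-∈ cmp ρ-sorted)
    where
    cmp : ∀ {r s} → r ∈ ρ → s ∈ ρ → Before lo (suc n ∸ s) (suc n ∸ r) → key (n ∸ r) ≼ key (n ∸ s)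
    cmp r∈ s∈ b with i , i< , refl ← ρ-value r∈ | j , j< , refl ← ρ-value s∈
      rewrite +-∸-assoc 1 (s≤s⁻¹ i<) | +-∸-assoc 1 (s≤s⁻¹ j<) with b
    ... | inj₁ lt = inj₁ (∸-monoʳ-< lt (lo≤ℓ (s≤s (m∸n≤m k i))))
    ... | inj₂ (e , s≤s lt) = inj₂ (cong (ℓ ∸_) (sym e) , ∸-monoʳ-≤ ℓ hi≤)
      where
      hi≤ : hi (k ∸ i) ≤ hi (k ∸ j)
      hi≤ with ord lt (s≤s (m∸n≤m k j))
      ... | inj₁ lt′      = <⇒≤ lt′
      ... | inj₂ (e′ , _) = ≤-reflexive e′

  ρ-keys-↭ : map (λ r → key (n ∸ r)) ρ ↭ map key (upTo n)
  ρ-keys-↭ = begin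
    map (λ r → key (n ∸ r)) ρ                                           ↭⟨ ↭.map⁺ _ (↭.map⁺ _ (↭-trans (↭-reverse π) perm)) ⟩
    map (λ r → key (n ∸ r)) (map (suc n ∸_) (map suc (upTo n)))         ≡⟨ map-∘ (map suc (upTo n)) ⟨
    map (λ u → key (n ∸ (suc n ∸ u))) (map suc (upTo n))                ≡⟨ map-∘ (upTo n) ⟨
    map (λ x → key (n ∸ (n ∸ x))) (upTo n)                              ≡⟨ map-cong-local (All.tabulate λ x∈ → cong key (m∸[m∸n]≡n (<⇒≤ (∈-upTo⁻ x∈)))) ⟩
    map key (upTo n)                                                    ∎
    where open PermutationReasoning

  position-unique : ∀ {p q} → p < n → q < n → at ρ p ≡ at ρ q → p ≡ q
  position-unique {p} {q} p< q< e with <-cmp p q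
  ... | tri≈ _ p≡q _ = p≡q
  ... | tri< p<q _ _ = ⊥-elim (contra (AllPairs-at ρ-sorted p<q (subst (q <_) (sym length-ρ) q<)))
    where
    contra : ¬ Before lo (suc n ∸ at ρ q) (suc n ∸ at ρ p)
    contra b rewrite e = Before-asym {lo} b b
  ... | tri> _ _ q<p = ⊥-elim (contra (AllPairs-at ρ-sorted q<p (subst (p <_) (sym length-ρ) p<)))
    where
    contra : ¬ Before lo (suc n ∸ at ρ p) (suc n ∸ at ρ q)
    contra b rewrite e = Before-asym {lo} b b

  position : ∀ {i} → i < n → ∃ λ p → p < n × at ρ p ≡ suc i × posOf (suc i) ρ ≡ suc p
  position i<n with p , p< , e , q ← posOf-correct ρ (value∈ρ i<n) = p , subst (p <_) length-ρ p< , e , q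

  inv≡ : inv ρ ≡ applyUpTo (λ i → posOf (suc i) ρ) n
  inv≡ rewrite length-ρ = map-upTo (λ i → posOf (suc i) ρ) n

  module _ {lob : ℕ → ℕ} (keys : ∀ {p} → p < n → ℓ ∸ hi (n ∸ at ρ p) ≡ lob p) where

    position-key : ∀ {i p} → p < n → at ρ p ≡ suc i → ℓ ∸ hi (k ∸ i) ≡ lob p
    position-key p< e = trans (cong (λ r → ℓ ∸ hi (n ∸ r)) (sym e)) (keys p<)

    -- As i grows the element k ∸ i falls, so by `ord` its `hi` weakly falls and its dual lower
    -- endpoint weakly rises.
    inv-sorted : AllPairs (Before lob) (inv ρ)
    inv-sorted rewrite inv≡ = AllPairs.applyUpTo⁺₁ _ n cmp
      where
      cmp : ∀ {i j} → i < j → j < n → Before lob (posOf (suc i) ρ) (posOf (suc j) ρ)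
      cmp {i} {j} i<j j<n with p , p< , e , q ← position (<-trans i<j j<n) | p′ , p′< , e′ , q′ ← position j<n
        rewrite q | q′ with labels< ← ∸-monoʳ-< i<j (s≤s⁻¹ j<n)
        with ord labels< (s≤s (m∸n≤m k i))
      ... | inj₁ lt = inj₁ (subst₂ _<_ (position-key p< e) (position-key p′< e′)
        (∸-monoʳ-< lt (hi≤ℓ (s≤s (m∸n≤m k i)))))
      ... | inj₂ (h≡ , l≥) = inj₂ (trans (sym (position-key p< e)) (trans (cong (ℓ ∸_) (sym h≡)) (position-key p′< e′)) , s≤s p′<p)
        where
        -- For equal `hi`, `ord` also gives lo (k ∸ i) ≤ lo (k ∸ j). Either way k ∸ i precedes k ∸ j
        -- in π, so it follows it in the reversal ρ.
        before : Before lo (suc (k ∸ i)) (suc (k ∸ j))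
        before with m≤n⇒m<n∨m≡n l≥
        ... | inj₁ lt = inj₁ lt
        ... | inj₂ l≡ = inj₂ (l≡ , s≤s labels<)
        contra : ¬ Before lo (suc n ∸ at ρ p′) (suc n ∸ at ρ p)
        contra rewrite e | e′ | +-∸-assoc 1 (s≤s⁻¹ (<-trans i<j j<n)) | +-∸-assoc 1 (s≤s⁻¹ j<n) = Before-asym {lo} before
        p′<p : p′ < p
        p′<p with <-cmp p p′
        ... | tri< p<p′ _ _ = ⊥-elim (contra (AllPairs-at ρ-sorted p<p′ (subst (p′ <_) (sym length-ρ) p′<)))
        ... | tri≈ _ refl _ = ⊥-elim (<⇒≢ i<j (suc-injective (trans (sym e) e′)))
        ... | tri> _ _ p′<p = p′<p

    inv-perm : inv ρ ↭ map suc (upTo n)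
    inv-perm = unique-↭ (AllPairs.map distinct inv-sorted)
      (Unique.map⁺ suc-injective (Unique.upTo⁺ n)) sound complete
      where
      distinct : ∀ {u v} → Before lob u v → u ≢ v
      distinct b refl = Before-asym {lob} b b
      sound : ∀ {v} → v ∈ inv ρ → v ∈ map suc (upTo n)
      sound v∈ with i , i∈ , refl ← ∈-map⁻ (λ i → posOf (suc i) ρ) v∈
        with p , p< , _ , q ← position (subst (i <_) length-ρ (∈-upTo⁻ i∈)) =
        subst (_∈ map suc (upTo n)) (sym q) (∈-map⁺ suc (∈-upTo⁺ p<))
      complete : ∀ {v} → v ∈ map suc (upTo n) → v ∈ inv ρ
      complete v∈ with p , p∈ , refl ← ∈-map⁻ suc v∈
        with p< ← ∈-upTo⁻ p∈
        with i , i< , e ← ρ-value (at-∈ {ρ} (subst (p <_) (sym length-ρ) p<))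
        with p′ , p′< , e′ , q ← position i<
        with refl ← position-unique p< p′< (trans e (sym e′)) =
        subst (_∈ inv ρ) q (∈-map⁺ (λ i → posOf (suc i) ρ) (∈-upTo⁺ (subst (i <_) (sym length-ρ) i<)))

-- Both sides are permutations of 1,...,n sorted by `Before lob`, hence equal.
dual-reading : ∀ {k ℓ lo hi r π kb ℓb lob hib rb πb} → kb ≡ k →
  State k ℓ lo hi → IntervalOrder k r lo hi → Reading k lo π → Restricted k ℓ lo hi →
  State kb ℓb lob hib → IntervalOrder kb rb lob hib → Reading kb lob πb → Dichotomy kb ℓb lob hib →
  mkP (suc kb) rb ≅P dual (mkP (suc k) r) →
  πb ≡ inv (compl (suc k) (rev π))
dual-reading {k} {ℓ} {lo} {hi} {r} {π} {_} {ℓb} {lob} {hib} {rb} {πb} refl S O R restricted Sb Ob Rb dichotomy iso =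
  AllPairs-↭⇒≡ (λ {x} {y} b b′ → ⊥-elim (Before-asym {lob} b b′)) (Reading.sorted Rb) (inv-sorted keys)
    (↭-trans (Reading.perm Rb) (↭-sym (inv-perm keys)))
  where
  open State S using (intervals; lo≤hi)
  open Restricted restricted
  open RevCompl intervals R ordered
  open Isomorphism (State.intervals Sb) Ob (intervals-dual intervals) (order-dual intervals O) iso
  open Inverse (proj₁ iso) using (to; from; strictlyInverseˡ)

  keyb : ℕ → ℕ × ℕ
  keyb y = lob y , hib y

  -- If d were a gap for `lob` and `hib`, the point interval at ℓ ∸ d would be reversed to [d , d]
  -- and the isomorphism would carry it into that gap.
  restricted-b : Dichotomy k ℓb lob hib → Ordered k lob hib
  restricted-b (inj₁ Q) = Restricted.ordered Q
  restricted-b (inj₂ U) with d , d≤ , none ← Unrestricted.gap U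
    with refl ← ℓ≡ with x , x< , p , q ← diagonal (m∸n≤m ℓ d) =
    ⊥-elim (none (toℕ<n y) (trans (lo≡ y) (back hi q)) (trans (hi≡ y) (back lo p)))
    where
    y = from (fromℕ< x<)
    back : ∀ (g : ℕ → ℕ) → g x ≡ ℓ ∸ d → ℓ ∸ g (toℕ (to y)) ≡ d
    back g e = trans (cong (λ z → ℓ ∸ g z) (trans (cong toℕ (strictlyInverseˡ (fromℕ< x<))) (toℕ-fromℕ< x<)))
      (trans (cong (ℓ ∸_) e) (m∸[m∸n]≡n d≤))

  keyb-sorted : AllPairs _≼_ (map keyb (upTo n))
  keyb-sorted rewrite map-upTo keyb n = AllPairs.applyUpTo⁺₁ keyb n (restricted-b dichotomy)

  keyb-↭ : map keyb (upTo n) ↭ map key (upTo n)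
  keyb-↭ = begin
    map keyb (upTo n)                        ↭⟨ ↭.map⁺ keyb (map-bijection-↭ (↔-id _)) ⟨
    map keyb (map toℕ (allFin n))            ≡⟨ map-∘ (allFin n) ⟨
    map (keyb ∘ toℕ) (allFin n)              ≡⟨ map-cong (λ y → cong₂ _,_ (lo≡ y) (hi≡ y)) (allFin n) ⟩
    map (key ∘ toℕ ∘ to) (allFin n)          ≡⟨ map-∘ (allFin n) ⟩
    map key (map (toℕ ∘ to) (allFin n))      ↭⟨ ↭.map⁺ key (map-bijection-↭ (proj₁ iso)) ⟩
    map key (upTo n)                         ∎
    where open PermutationReasoning

  -- Two sorted arrangements of the same pairs agree entry by entry, even where the isomorphism
  -- pairs up different elements with equal intervals.
  keys : ∀ {p} → p < n → ℓ ∸ hi (n ∸ at ρ p) ≡ lob p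
  keys {p} p< = cong proj₁ (map-≡-applyUpTo {h = λ r → key (n ∸ r)} {k = keyb} ρ n
    (trans (AllPairs-↭⇒≡ ≼-antisym ρ-keys-sorted keyb-sorted (↭-trans ρ-keys-↭ (↭-sym keyb-↭))) (map-upTo keyb n))
    (subst (p <_) (sym length-ρ) p<))

theorem4p13 : ∀ (n : ℕ) (π : List ℕ) → IsPerm n π → Avoids31̄524̄ π →
    ∀ (a : List ℕ) → IsAscent a → length a ≡ n → fAS a ≡ π →
    ∀ (b : List ℕ) → IsAscent b → fAP b ≅P dual (fAP a) →
    fAS b ≡ inv (compl n (rev π))
theorem4p13 n π perm avoids a asc-a _ refl b asc-b iso =
  subst (λ m → fAS b ≡ inv (compl m (rev π))) size≡n
    (dual-reading (suc-injective (↔⇒≡ (proj₁ iso′))) A.state A.order A.reading (restricted A.dichotomy)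
      B.state B.order B.reading B.dichotomy iso′)
  where
  module A = Built (built a asc-a)
  module B = Built (built b asc-b)
  iso′ : mkP (suc B.k) B.r ≅P dual (mkP (suc A.k) A.r)
  iso′ = subst₂ (λ P Q → P ≅P dual Q) B.poset≡ A.poset≡ iso
  restricted : Dichotomy A.k A.ℓ A.lo A.hi → Restricted A.k A.ℓ A.lo A.hi
  restricted (inj₁ Q) = Q
  restricted (inj₂ U) = ⊥-elim (avoids⇒¬bad A.reading avoids (Unrestricted.bad U))
  size≡n : suc A.k ≡ n
  size≡n = trans (sym (Reading.length≡ A.reading))
    (trans (↭-length perm) (trans (length-map suc (upTo n)) (length-upTo n)))
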